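{- Suppose the following statement is true: for all abelian groups $M,M'$ and all symmetric subsets $B\subseteq M$, $B'\subseteq M'$, if there is a graph homomorphism from $\mathrm{Cay}(M,B)$ to $\mathrm{Cay}(M',B')$, then every graph with an $(M,B)$-flow has an $(M',B')$-flow. Then every bridgeless graph has an orientable cycle double cover with at most $6$ cycles.
   Context: Graphs are finite; loops and parallel edges are allowed. A subset $B$ of an abelian group is symmetric if $B=-B$. $\mathrm{Cay}(M,B)$ is the graph with vertex set $M$ in which $x,y$ are adjacent iff $y-x\in B$ (there is a loop at every vertex if $0\in B$); groups may be infinite. A graph homomorphism is a map of vertex sets sending adjacent vertices to adjacent vertices. For an abelian group $M$, an $M$-flow on a directed graph $G=(V,E)$ is a mapping $\varphi\colon E\to M$ such that at every vertex $v$ the sum of $\varphi$ over edges leaving $v$ minus the sum of $\varphi$ over edges entering $v$ is $0$; it is an $(M,B)$-flow if $\varphi(e)\in B$ for all $e\in E$. Since $B$ is symmetric, the existence of an $(M,B)$-flow does not depend on the chosen orientation of the edges, so it makes sense for undirected graphs too. Fix an arbitrary orientation of $G$. A directed cycle is a $\mathbb{Z}$-flow $C\colon E\to\mathbb{Z}$ with all values in $\{ -1,0,1\}$ (so it need not be connected and may be identically zero). An orientable cycle double cover of $G$ is an indexed family of directed cycles covering each edge exactly twice, once in each direction, i.e. for every edge $e$ exactly one member of the family has value $+1$ on $e$, exactly one has value $-1$ on $e$, and all others have value $0$ on $e$. -}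

module Defs where

open import Algebra.Bundles using (AbelianGroup)
import Algebra.Properties.CommutativeMonoid.Sum as Sum
open import Data.Bool.Base using (if_then_else_)
open import Data.Fin.Base using (Fin)
open import Data.Fin.Properties using (_≟_)
open import Data.Integer.Base using (ℤ; 0ℤ; 1ℤ; -1ℤ)
open import Data.Integer.Properties using (+-0-abelianGroup)
open import Data.Nat.Base using (ℕ; _≤_)
open import Data.Product.Base using (Σ-syntax; ∃-syntax; _×_)
open import Data.Product using (∃!)
open import Data.Sum.Base using (_⊎_)
open import Function.Base using (_∘_)
open import Level using (Level; 0ℓ; _⊔_; suc)
open import Relation.Binary.Construct.Closure.Equivalence using (EqClosure)
open import Relation.Binary.Core using (Rel)
open import Relation.Binary.Definitions using (_Respects_)
open import Relation.Binary.PropositionalEquality.Core using (_≡_; _≢_)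
open import Relation.Nullary using (¬_; does)
open import Relation.Unary using (Pred; U; _≐_)

-- A finite graph (loops and parallel edges allowed) together with an arbitrary
-- reference orientation: edge e is directed from tail e to head e.  Whether G
-- is bridgeless, has an (M , B)-flow for symmetric B, or has an orientable
-- cycle double cover does not depend on the orientation, so quantifying over
-- Graph is quantifying over undirected graphs.
record Graph : Set where
  field
    #V #E     : ℕ
    tail head : Fin #E → Fin #V

  Vertex Edge : Set
  Vertex = Fin #V
  Edge   = Fin #E

module _ (G : Graph) where
  open Graph G

  Connected : ∀ {p} → Pred Edge p → Rel Vertex p
  Connected P = EqClosure λ u v → ∃[ e ] P e × tail e ≡ u × head e ≡ v

  -- Deleting e splits a component of G.
  IsBridge : Edge → Set
  IsBridge e = ∃[ u ] ∃[ v ] Connected U u v × ¬ Connected (_≢ e) u v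

  Bridgeless : Set
  Bridgeless = ∀ e → ¬ IsBridge e

  module _ {c ℓ : Level} (M : AbelianGroup c ℓ) where
    open AbelianGroup M
    open Sum commutativeMonoid using (sum)

    outflow inflow : (Edge → Carrier) → Vertex → Carrier
    outflow φ v = sum λ e → if does (tail e ≟ v) then φ e else ε
    inflow  φ v = sum λ e → if does (head e ≟ v) then φ e else ε

    IsFlow : (Edge → Carrier) → Set ℓ
    IsFlow φ = ∀ v → outflow φ v - inflow φ v ≈ ε

    HasFlow : ∀ {p} → Pred Carrier p → Set (c ⊔ ℓ ⊔ p)
    HasFlow B = Σ[ φ ∈ (Edge → Carrier) ] IsFlow φ × (∀ e → B (φ e))

  IsDirectedCycle : (Edge → ℤ) → Set
  IsDirectedCycle C =
    IsFlow +-0-abelianGroup C × (∀ e → C e ≡ -1ℤ ⊎ C e ≡ 0ℤ ⊎ C e ≡ 1ℤ)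

  record IsOrientableCycleDoubleCover {k : ℕ} (C : Fin k → Edge → ℤ) : Set where
    field
      cycles   : ∀ i → IsDirectedCycle (C i)
      forward  : ∀ e → ∃! _≡_ λ i → C i e ≡ 1ℤ
      backward : ∀ e → ∃! _≡_ λ i → C i e ≡ -1ℤ
      others   : ∀ e i → C i e ≢ 1ℤ → C i e ≢ -1ℤ → C i e ≡ 0ℤ

  HasOrientableCycleDoubleCoverOfSize≤ : ℕ → Set
  HasOrientableCycleDoubleCoverOfSize≤ n =
    ∃[ k ] k ≤ n × Σ[ C ∈ (Fin k → Edge → ℤ) ] IsOrientableCycleDoubleCover C

-- The carrier of an AbelianGroup is a setoid, so a subset must respect _≈_.
record SymmetricSubset {c ℓ : Level} (M : AbelianGroup c ℓ) (p : Level)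
       : Set (c ⊔ ℓ ⊔ suc p) where
  open AbelianGroup M
  field
    _∈B       : Pred Carrier p
    respects  : _∈B Respects _≈_
    symmetric : _∈B ≐ (_∈B ∘ _⁻¹)

module _ {c ℓ p : Level} (M : AbelianGroup c ℓ) (B : SymmetricSubset M p) where
  open AbelianGroup M
  open SymmetricSubset B

  -- Possibly infinite, with loops: represented by its adjacency relation, which
  -- is symmetric because B is.
  Cay : Rel Carrier p
  Cay x y = (y - x) ∈B

record CayHom {c ℓ p c′ ℓ′ p′ : Level}
       (M  : AbelianGroup c  ℓ ) (B  : SymmetricSubset M  p )
       (M′ : AbelianGroup c′ ℓ′) (B′ : SymmetricSubset M′ p′)
       : Set (c ⊔ ℓ ⊔ p ⊔ c′ ⊔ ℓ′ ⊔ p′) where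
  private
    module M  = AbelianGroup M
    module M′ = AbelianGroup M′
  field
    f         : M.Carrier → M′.Carrier
    cong      : ∀ {x y} → x M.≈ y → f x M′.≈ f y
    adjacency : ∀ {x y} → Cay M B x y → Cay M′ B′ (f x) (f y)

-- Groups and subsets are taken at the lowest universe level, which makes this
-- the weakest instance: any higher-level version implies it by lifting.
CayleyHomsPreserveFlows : Set₁
CayleyHomsPreserveFlows =
  (M M′ : AbelianGroup 0ℓ 0ℓ)
  (B : SymmetricSubset M 0ℓ) (B′ : SymmetricSubset M′ 0ℓ) →
  CayHom M B M′ B′ →
  (G : Graph) →
  HasFlow G M  (SymmetricSubset._∈B B) →
  HasFlow G M′ (SymmetricSubset._∈B B′)

{-# OPTIONS --safe #-}
module Submission where

-- A colouring of Cay(ℤ/6, nonzero elements) = K₆ by the unit vectors of ℤ⁶ is a homomorphism to the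
-- Cayley graph of the differences of two unit vectors, and a flow with such values is an orientable
-- double cover by six cycles. So it suffices to find a nowhere-zero 6-flow 3α + 2β (Seymour), with α
-- balanced modulo 2 and β modulo 3. It is built by contracting larger and larger vertex sets Z, in
-- the manner of DeVos and Nurse: find a connected even subgraph disjoint from Z and joined to Z by at
-- least two edges, solve the problem with its vertices added to Z, and put α = ±1 on the subgraph.
-- The two edges to Z allow β to be corrected on the boundary of the subgraph, and connectedness
-- allows β to be corrected inside, where it is unconstrained. When only one edge to Z is available it
-- belongs to a 2-edge cut and can be contracted.

open import Defs

open import Algebra.Bundles using (AbelianGroup)
import Algebra.Construct.Pointwise as Pointwise
import Algebra.Properties.CommutativeMonoid.Sum as Sum
open import Algebra.Properties.Semiring.Sum using (*-distribˡ-sum)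
open import Data.Bool.Base using (Bool; true; false; if_then_else_)
open import Data.Bool.Properties using (if-float)
open import Data.Empty using (⊥-elim)
open import Data.Fin.Base using (Fin; zero; suc; fromℕ<)
open import Data.Fin.Properties using (any?; fromℕ<-cong; fromℕ<-injective) renaming (_≟_ to _≟ᶠ_)
open import Data.Fin.Subset using (Subset; _∈_; _∉_; _⊆_; _⊂_; _∪_; _∩_; ∁; ⁅_⁆; ⊥)
open import Data.Fin.Subset.Induction using (Acc; acc; ⊂-wellFounded; ⊃-wellFounded)
open import Data.Fin.Subset.Properties
  using (_∈?_; ∉⊥; x∈⁅x⁆; x∈⁅y⁆⇒x≡y; p⊆p∪q; q⊆p∪q; x∈p∪q⁻;
         x∈p∩q⁺; x∈p∩q⁻; p∩q⊆p; x∉p⇒x∈∁p; x∈∁p⇒x∉p)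
open import Data.Integer.Base using (ℤ; +_; 0ℤ; 1ℤ; -1ℤ; _+_; _*_; -_; _-_; _≤_; +≤+) renaming (∣_∣ to abs)
open import Data.Integer.Divisibility.Signed
  using (_∣_; divides; ∣-trans; ∣⇒∣ᵤ; ∣m∣n⇒∣m+n; ∣m∣n⇒∣m-n; ∣m⇒∣-m; ∣n⇒∣m*n; ∣m⇒∣m*n)
open import Data.Integer.DivMod using (_%ℕ_; _/ℕ_; n%ℕd<d; a≡a%ℕn+[a/ℕn]*n)
open import Data.Integer.Properties
  using (+-*-semiring; +-0-abelianGroup; +-0-commutativeMonoid; +-identityʳ; +-identityˡ;
         +-inverseʳ; +-inverseˡ; +-assoc; +-comm; *-zeroʳ; *-zeroˡ; *-identityʳ; *-identityˡ;
         +-mono-≤; m-n≡m⊖n; ∣m⊝n∣≤m⊔n; ∣i∣≡0⇒i≡0; i-j≡0⇒i≡j; +-injective; neg-involutive; ≤-reflexive)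
  renaming (_≟_ to _≟ᶻ_; ≤-refl to ≤ᶻ-refl; ≤-trans to ≤ᶻ-trans)
open import Data.Integer.Tactic.RingSolver using (solve-∀)
import Data.Nat.Base as ℕ
import Data.Nat.Divisibility as ℕ
import Data.Nat.Properties as ℕ
open import Data.Product.Base using (Σ; Σ-syntax; ∃-syntax; ∃; _×_; _,_; proj₁; proj₂)
open import Data.Product using (∃!)
open import Data.Sum.Base using (_⊎_; inj₁; inj₂; [_,_]′; map₂)
open import Function.Base using (_∘_; _∘′_)
open import Level using (0ℓ)
open import Relation.Binary.Construct.Closure.Equivalence using (gfold; return)
open import Relation.Binary.PropositionalEquality
  using (_≡_; _≢_; refl; sym; trans; cong; cong₂; subst; isEquivalence; module ≡-Reasoning)
open import Relation.Nullary using (¬_; Dec; yes; no; does; contradiction; ¬?; _×-dec_; _⊎-dec_)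
open import Relation.Nullary.Decidable using (dec-true; dec-false; map′)

open Sum +-0-commutativeMonoid using (sum; sum-cong-≗; sum-replicate-zero; ∑-distrib-+; ∑-comm)

-- Integer sums and indicators

sum-zero : ∀ {n} {f : Fin n → ℤ} → (∀ i → f i ≡ 0ℤ) → sum f ≡ 0ℤ
sum-zero {n} f≡0 = trans (sum-cong-≗ f≡0) (sum-replicate-zero n)

sum-single : ∀ {n} {f : Fin n → ℤ} i → (∀ j → j ≢ i → f j ≡ 0ℤ) → sum f ≡ f i
sum-single {f = f} zero f≡0 =
  trans (cong (_+_ (f zero)) (sum-zero λ j → f≡0 (suc j) λ ())) (+-identityʳ _)
sum-single {f = f} (suc i) f≡0 =
  trans (cong₂ _+_ (f≡0 zero λ ()) (sum-single i λ j j≢i → f≡0 (suc j) λ { refl → j≢i refl }))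
        (+-identityˡ _)

sum-pair : ∀ {n} {f : Fin n → ℤ} i j → i ≢ j →
           (∀ k → k ≢ i → k ≢ j → f k ≡ 0ℤ) → sum f ≡ f i + f j
sum-pair zero zero i≢j f≡0 = contradiction refl i≢j
sum-pair {f = f} zero (suc j) i≢j f≡0 =
  cong (_+_ (f zero)) (sum-single j λ k k≢j → f≡0 (suc k) (λ ()) λ { refl → k≢j refl })
sum-pair {f = f} (suc i) zero i≢j f≡0 =
  trans (cong (_+_ (f zero)) (sum-single i λ k k≢i → f≡0 (suc k) (λ { refl → k≢i refl }) (λ ())))
        (+-comm (f zero) _)
sum-pair (suc i) (suc j) i≢j f≡0 =
  trans (cong₂ _+_ (f≡0 zero (λ ()) (λ ()))
                   (sum-pair i j (i≢j ∘′ cong suc)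
                     λ k k≢i k≢j → f≡0 (suc k) (λ { refl → k≢i refl }) (λ { refl → k≢j refl })))
        (+-identityˡ _)

sum-nonNeg : ∀ {n} {f : Fin n → ℤ} → (∀ i → 0ℤ ≤ f i) → 0ℤ ≤ sum f
sum-nonNeg {ℕ.zero}  f≥0 = ≤ᶻ-refl
sum-nonNeg {ℕ.suc n} f≥0 = +-mono-≤ (f≥0 zero) (sum-nonNeg (f≥0 ∘ suc))

term≤sum : ∀ {n} {f : Fin n → ℤ} → (∀ i → 0ℤ ≤ f i) → ∀ i → f i ≤ sum f
term≤sum {f = f} f≥0 zero =
  subst (_≤ sum f) (+-identityʳ _) (+-mono-≤ (≤ᶻ-refl {f zero}) (sum-nonNeg (f≥0 ∘ suc)))
term≤sum {f = f} f≥0 (suc i) =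
  subst (_≤ sum f) (+-identityˡ _) (+-mono-≤ (f≥0 zero) (term≤sum (f≥0 ∘ suc) i))

pair≤sum : ∀ {n} {f : Fin n → ℤ} → (∀ i → 0ℤ ≤ f i) → ∀ i j → i ≢ j → f i + f j ≤ sum f
pair≤sum f≥0 zero zero i≢j = contradiction refl i≢j
pair≤sum {f = f} f≥0 zero (suc j) i≢j = +-mono-≤ (≤ᶻ-refl {f zero}) (term≤sum (f≥0 ∘ suc) j)
pair≤sum {f = f} f≥0 (suc i) zero i≢j =
  subst (_≤ sum f) (+-comm (f zero) _) (+-mono-≤ (≤ᶻ-refl {f zero}) (term≤sum (f≥0 ∘ suc) i))
pair≤sum {f = f} f≥0 (suc i) (suc j) i≢j =
  subst (_≤ sum f) (+-identityˡ _)
        (+-mono-≤ (f≥0 zero) (pair≤sum (f≥0 ∘ suc) i j (i≢j ∘′ cong suc)))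

sum-scale : ∀ {n} c (f : Fin n → ℤ) → sum (λ i → c * f i) ≡ c * sum f
sum-scale c f = sym (*-distribˡ-sum +-*-semiring c f)

∣-sum : ∀ {n d} {f : Fin n → ℤ} → (∀ i → d ∣ f i) → d ∣ sum f
∣-sum {ℕ.zero}  {d} d∣f = divides 0ℤ (sym (*-zeroˡ d))
∣-sum {ℕ.suc n}     d∣f = ∣m∣n⇒∣m+n (d∣f zero) (∣-sum (d∣f ∘ suc))

⟦_⟧ : ∀ {P : Set} → Dec P → ℤ
⟦ P? ⟧ = if does P? then 1ℤ else 0ℤ

⟦⟧-yes : ∀ {P : Set} (P? : Dec P) → P → ⟦ P? ⟧ ≡ 1ℤ
⟦⟧-yes P? p rewrite dec-true P? p = refl

⟦⟧-no : ∀ {P : Set} (P? : Dec P) → ¬ P → ⟦ P? ⟧ ≡ 0ℤ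
⟦⟧-no P? ¬p rewrite dec-false P? ¬p = refl

δ : ∀ {n} → Fin n → Fin n → ℤ
δ i j = ⟦ i ≟ᶠ j ⟧

δ-refl : ∀ {n} (i : Fin n) → δ i i ≡ 1ℤ
δ-refl i = ⟦⟧-yes (i ≟ᶠ i) refl

δ-≢ : ∀ {n} {i j : Fin n} → i ≢ j → δ i j ≡ 0ℤ
δ-≢ {i = i} {j} = ⟦⟧-no (i ≟ᶠ j)

δ-sym : ∀ {n} (i j : Fin n) → δ i j ≡ δ j i
δ-sym i j with i ≟ᶠ j
... | yes refl = sym (δ-refl i)
... | no  i≢j  = sym (δ-≢ (i≢j ∘ sym))

𝟙 : ∀ {n} → Subset n → Fin n → ℤ
𝟙 Q v = ⟦ v ∈? Q ⟧

𝟙-∈ : ∀ {n} {Q : Subset n} {v} → v ∈ Q → 𝟙 Q v ≡ 1ℤ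
𝟙-∈ {Q = Q} {v} = ⟦⟧-yes (v ∈? Q)

𝟙-∉ : ∀ {n} {Q : Subset n} {v} → v ∉ Q → 𝟙 Q v ≡ 0ℤ
𝟙-∉ {Q = Q} {v} = ⟦⟧-no (v ∈? Q)

sum-δ : ∀ {n} i (f : Fin n → ℤ) → sum (λ j → f j * δ i j) ≡ f i
sum-δ i f =
  trans (sum-single i λ j j≢i → trans (cong (f j *_) (δ-≢ (j≢i ∘ sym))) (*-zeroʳ (f j)))
        (trans (cong (f i *_) (δ-refl i)) (*-identityʳ (f i)))

sum-δ-δ : ∀ {n} i j (f : Fin n → ℤ) → sum (λ k → f k * (δ i k - δ j k)) ≡ f i - f j
sum-δ-δ i j f = begin
  sum (λ k → f k * (δ i k - δ j k))
    ≡⟨ sum-cong-≗ (λ k → expand (f k) (δ i k) (δ j k)) ⟩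
  sum (λ k → f k * δ i k + -1ℤ * (f k * δ j k))
    ≡⟨ ∑-distrib-+ (λ k → f k * δ i k) (λ k → -1ℤ * (f k * δ j k)) ⟩
  sum (λ k → f k * δ i k) + sum (λ k → -1ℤ * (f k * δ j k))
    ≡⟨ cong₂ _+_ (sum-δ i f) (trans (sum-scale -1ℤ (λ k → f k * δ j k)) (cong (-1ℤ *_) (sum-δ j f))) ⟩
  f i + -1ℤ * f j
    ≡⟨ collect (f i) (f j) ⟩
  f i - f j ∎
  where
  open ≡-Reasoning
  expand : ∀ a b c → a * (b - c) ≡ a * b + -1ℤ * (a * c)
  expand = solve-∀
  collect : ∀ a b → a + -1ℤ * b ≡ a - b
  collect = solve-∀

-- Arithmetic modulo 3

mod3 : ∀ n → + 3 ∣ n ⊎ + 3 ∣ n - 1ℤ ⊎ + 3 ∣ n + 1ℤ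
mod3 n with n %ℕ 3 | n /ℕ 3 | n%ℕd<d n 3 | a≡a%ℕn+[a/ℕn]*n n 3
... | 0 | q | _ | refl = inj₁ (divides q (+-identityˡ _))
... | 1 | q | _ | refl = inj₂ (inj₁ (divides q (lemma q)))
  where
  lemma : ∀ q → 1ℤ + q * + 3 - 1ℤ ≡ q * + 3
  lemma = solve-∀
... | 2 | q | _ | refl = inj₂ (inj₂ (divides (q + 1ℤ) (lemma q)))
  where
  lemma : ∀ q → + 2 + q * + 3 + 1ℤ ≡ (q + 1ℤ) * + 3
  lemma = solve-∀
... | ℕ.suc (ℕ.suc (ℕ.suc _)) | q | ℕ.s≤s (ℕ.s≤s (ℕ.s≤s ())) | _

3∤⇒±1 : ∀ {n} → ¬ + 3 ∣ n → + 3 ∣ n - 1ℤ ⊎ + 3 ∣ n + 1ℤ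
3∤⇒±1 {n} 3∤n with mod3 n
... | inj₁ 3∣n = contradiction 3∣n 3∤n
... | inj₂ r   = r

data Bit : ℤ → Set where
  bit₀ : Bit 0ℤ
  bit₁ : Bit 1ℤ

-- Both `u` and `w` are 1 or -1 modulo 3. If they agree, then 0, `u` and `u + w` are all the
-- residues; if they differ, then 0, `u` and `w` are.
fix-mod3 : ∀ t {u w} → ¬ + 3 ∣ u → ¬ + 3 ∣ w →
           ∃[ i ] ∃[ j ] Bit i × Bit j × + 3 ∣ t + (i * u + j * w)
fix-mod3 t {u} {w} 3∤u 3∤w with mod3 t | 3∤⇒±1 3∤u | 3∤⇒±1 3∤w
... | inj₁ p | _ | _ = 0ℤ , 0ℤ , bit₀ , bit₀ , subst (+ 3 ∣_) (lemma t u w) p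
  where
  lemma : ∀ t u w → t ≡ t + (0ℤ * u + 0ℤ * w)
  lemma = solve-∀
... | inj₂ (inj₁ p) | inj₂ q | _ =
  1ℤ , 0ℤ , bit₁ , bit₀ , subst (+ 3 ∣_) (lemma t u w) (∣m∣n⇒∣m+n p q)
  where
  lemma : ∀ t u w → t - 1ℤ + (u + 1ℤ) ≡ t + (1ℤ * u + 0ℤ * w)
  lemma = solve-∀
... | inj₂ (inj₂ p) | inj₁ q | _ =
  1ℤ , 0ℤ , bit₁ , bit₀ , subst (+ 3 ∣_) (lemma t u w) (∣m∣n⇒∣m+n p q)
  where
  lemma : ∀ t u w → t + 1ℤ + (u - 1ℤ) ≡ t + (1ℤ * u + 0ℤ * w)
  lemma = solve-∀
... | inj₂ (inj₁ p) | inj₁ _ | inj₂ r =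
  0ℤ , 1ℤ , bit₀ , bit₁ , subst (+ 3 ∣_) (lemma t u w) (∣m∣n⇒∣m+n p r)
  where
  lemma : ∀ t u w → t - 1ℤ + (w + 1ℤ) ≡ t + (0ℤ * u + 1ℤ * w)
  lemma = solve-∀
... | inj₂ (inj₂ p) | inj₂ _ | inj₁ r =
  0ℤ , 1ℤ , bit₀ , bit₁ , subst (+ 3 ∣_) (lemma t u w) (∣m∣n⇒∣m+n p r)
  where
  lemma : ∀ t u w → t + 1ℤ + (w - 1ℤ) ≡ t + (0ℤ * u + 1ℤ * w)
  lemma = solve-∀
... | inj₂ (inj₁ p) | inj₁ q | inj₁ r =
  1ℤ , 1ℤ , bit₁ , bit₁ ,
  subst (+ 3 ∣_) (lemma t u w) (∣m∣n⇒∣m+n (∣m∣n⇒∣m+n p (∣m∣n⇒∣m+n q r)) (divides 1ℤ refl))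
  where
  lemma : ∀ t u w → t - 1ℤ + (u - 1ℤ + (w - 1ℤ)) + + 3 ≡ t + (1ℤ * u + 1ℤ * w)
  lemma = solve-∀
... | inj₂ (inj₂ p) | inj₂ q | inj₂ r =
  1ℤ , 1ℤ , bit₁ , bit₁ ,
  subst (+ 3 ∣_) (lemma t u w) (∣m∣n⇒∣m+n (∣m∣n⇒∣m+n p (∣m∣n⇒∣m+n q r)) (divides -1ℤ refl))
  where
  lemma : ∀ t u w → t + 1ℤ + (u + 1ℤ + (w + 1ℤ)) + - (+ 3) ≡ t + (1ℤ * u + 1ℤ * w)
  lemma = solve-∀

-- A coefficient 0 or 1 turns `b` into `b` or `2b`, and 2 is invertible modulo 3. A coefficient -1
-- would give 0, hence the restriction to `Bit`.
3∤-double : ∀ {i b} → Bit i → ¬ + 3 ∣ b → ¬ + 3 ∣ b + i * b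
3∤-double {b = b} bit₀ 3∤b p = 3∤b (subst (+ 3 ∣_) (+-identityʳ b) p)
3∤-double {b = b} bit₁ 3∤b p = 3∤b (subst (+ 3 ∣_) (lemma b) (∣m∣n⇒∣m-n (divides b refl) p))
  where
  lemma : ∀ b → b * + 3 - (b + 1ℤ * b) ≡ b
  lemma = solve-∀

-- Directions as Booleans, and their signs

∃Bool? : {P : Bool → Set} → (∀ b → Dec (P b)) → Dec (∃ P)
∃Bool? P? = map′ [ true ,_ , false ,_ ]′ (λ { (true , p) → inj₁ p ; (false , p) → inj₂ p })
                 (P? true ⊎-dec P? false)

AtMostOne : {A : Set} → (A → Set) → Set
AtMostOne P = ∀ {e f} → P e → P f → e ≡ f

sgn : Bool → ℤ
sgn true  = 1ℤ
sgn false = -1ℤ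

sgn-square : ∀ b → sgn b * sgn b ≡ 1ℤ
sgn-square true  = refl
sgn-square false = refl

∣-sgn : ∀ {d n} b → d ∣ n * sgn b → d ∣ n
∣-sgn {d} {n} b p = subst (d ∣_) eq (∣m⇒∣m*n (sgn b) p)
  where
  assoc : ∀ a c → a * c * c ≡ a * (c * c)
  assoc = solve-∀
  eq : n * sgn b * sgn b ≡ n
  eq = trans (assoc n (sgn b)) (trans (cong (n *_) (sgn-square b)) (*-identityʳ n))

module _ (G : Graph) where
  open Graph G

  -- Net outflow and cuts

  inc : Edge → Vertex → ℤ
  inc e v = δ (tail e) v - δ (head e) v

  net : (Edge → ℤ) → Vertex → ℤ
  net φ v = sum λ e → φ e * inc e v

  cross : Subset #V → Edge → ℤ
  cross Q e = 𝟙 Q (tail e) - 𝟙 Q (head e)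

  -- An arc is an edge e with a direction: true is the reference orientation.
  src tgt : Edge → Bool → Vertex
  src e true  = tail e
  src e false = head e
  tgt e true  = head e
  tgt e false = tail e

  Leaves : Subset #V → Edge → Set
  Leaves Q e = ∃[ b ] src e b ∈ Q × tgt e b ∉ Q

  leaves? : ∀ Q e → Dec (Leaves Q e)
  leaves? Q e = ∃Bool? λ b → (src e b ∈? Q) ×-dec ¬? (tgt e b ∈? Q)

  inc-arc : ∀ e b v → sgn b * inc e v ≡ δ (src e b) v - δ (tgt e b) v
  inc-arc e true  v = *-identityˡ _
  inc-arc e false v = lemma (δ (tail e) v) (δ (head e) v)
    where
    lemma : ∀ s t → -1ℤ * (s - t) ≡ t - s
    lemma = solve-∀

  inc-off : ∀ {e v} → tail e ≢ v → head e ≢ v → inc e v ≡ 0ℤ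
  inc-off t≢v h≢v = cong₂ _-_ (δ-≢ t≢v) (δ-≢ h≢v)

  inc-arc-off : ∀ {e v} b → src e b ≢ v → tgt e b ≢ v → inc e v ≡ 0ℤ
  inc-arc-off true  s t = inc-off s t
  inc-arc-off false s t = inc-off t s

  cross-leaves : ∀ {Q e} b → src e b ∈ Q → tgt e b ∉ Q → cross Q e ≡ sgn b
  cross-leaves true  s∈Q t∉Q = cong₂ _-_ (𝟙-∈ s∈Q) (𝟙-∉ t∉Q)
  cross-leaves false s∈Q t∉Q = cong₂ _-_ (𝟙-∉ t∉Q) (𝟙-∈ s∈Q)

  cross-stays : ∀ {Q e} → ¬ Leaves Q e → cross Q e ≡ 0ℤ
  cross-stays {Q} {e} stays with tail e ∈? Q | head e ∈? Q
  ... | yes _ | yes _ = refl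
  ... | no  _ | no  _ = refl
  ... | yes t | no  h = contradiction (true , t , h) stays
  ... | no  t | yes h = contradiction (false , h , t) stays

  net-+ : ∀ φ ψ v → net (λ e → φ e + ψ e) v ≡ net φ v + net ψ v
  net-+ φ ψ v = trans (sum-cong-≗ λ e → distrib (φ e) (ψ e) (inc e v))
                      (∑-distrib-+ (λ e → φ e * inc e v) (λ e → ψ e * inc e v))
    where
    distrib : ∀ a b c → (a + b) * c ≡ a * c + b * c
    distrib = solve-∀

  net-scale : ∀ c φ v → net (λ e → c * φ e) v ≡ c * net φ v
  net-scale c φ v = trans (sum-cong-≗ λ e → assoc c (φ e) (inc e v))
                          (sum-scale c λ e → φ e * inc e v)
    where
    assoc : ∀ a b d → a * b * d ≡ a * (b * d)
    assoc = solve-∀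

  net-sum : ∀ {n} (c : Fin n → ℤ) (p : Fin n → Edge → ℤ) v →
            net (λ e → sum λ w → c w * p w e) v ≡ sum λ w → c w * net (p w) v
  net-sum {ℕ.zero}  c p v = sum-zero λ e → *-zeroˡ (inc e v)
  net-sum {ℕ.suc n} c p v = begin
    net (λ e → c zero * p zero e + rest e) v
      ≡⟨ net-+ (λ e → c zero * p zero e) rest v ⟩
    net (λ e → c zero * p zero e) v + net rest v
      ≡⟨ cong₂ _+_ (net-scale (c zero) (p zero) v) (net-sum (c ∘ suc) (p ∘ suc) v) ⟩
    c zero * net (p zero) v + sum (λ w → c (suc w) * net (p (suc w)) v) ∎
    where
    open ≡-Reasoning
    rest : Edge → ℤ
    rest e = sum λ w → c (suc w) * p (suc w) e

  net-δ : ∀ c e v → net (λ h → c * δ e h) v ≡ c * inc e v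
  net-δ c e v = trans (sum-cong-≗ λ h → swap c (δ e h) (inc h v)) (sum-δ e λ h → c * inc h v)
    where
    swap : ∀ a b d → a * b * d ≡ a * d * b
    swap = solve-∀

  net-cong : ∀ {φ ψ} v → (∀ e → inc e v ≡ 0ℤ ⊎ φ e ≡ ψ e) → net φ v ≡ net ψ v
  net-cong {φ} {ψ} v eq = sum-cong-≗ λ e → [ vanish e , cong (_* inc e v) ]′ (eq e)
    where
    vanish : ∀ e → inc e v ≡ 0ℤ → φ e * inc e v ≡ ψ e * inc e v
    vanish e i≡0 rewrite i≡0 = trans (*-zeroʳ (φ e)) (sym (*-zeroʳ (ψ e)))

  net-zero : ∀ {φ} v → (∀ e → inc e v ≡ 0ℤ ⊎ φ e ≡ 0ℤ) → net φ v ≡ 0ℤ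
  net-zero v eq = trans (net-cong v eq) (sum-zero λ e → *-zeroˡ (inc e v))

  -- Exchanging the sums over vertices and edges leaves each edge with `φ e` times the difference of
  -- the indicators at its ends, so edges within one side of the cut drop out.
  net-cut : ∀ Q φ → sum (λ v → 𝟙 Q v * net φ v) ≡ sum (λ e → φ e * cross Q e)
  net-cut Q φ = begin
    sum (λ v → 𝟙 Q v * net φ v)
      ≡⟨ sum-cong-≗ (λ v → sum-scale (𝟙 Q v) (λ e → φ e * inc e v)) ⟨
    sum (λ v → sum λ e → 𝟙 Q v * (φ e * inc e v))
      ≡⟨ ∑-comm (λ v e → 𝟙 Q v * (φ e * inc e v)) ⟩
    sum (λ e → sum λ v → 𝟙 Q v * (φ e * inc e v))
      ≡⟨ sum-cong-≗ (λ e → sum-cong-≗ λ v → swap (𝟙 Q v) (φ e) (inc e v)) ⟩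
    sum (λ e → sum λ v → φ e * 𝟙 Q v * inc e v)
      ≡⟨ sum-cong-≗ (λ e → sum-δ-δ (tail e) (head e) (λ v → φ e * 𝟙 Q v)) ⟩
    sum (λ e → φ e * 𝟙 Q (tail e) - φ e * 𝟙 Q (head e))
      ≡⟨ sum-cong-≗ (λ e → factor (φ e) (𝟙 Q (tail e)) (𝟙 Q (head e))) ⟩
    sum (λ e → φ e * cross Q e) ∎
    where
    open ≡-Reasoning
    swap : ∀ a b c → a * (b * c) ≡ b * a * c
    swap = solve-∀
    factor : ∀ a b c → a * b - a * c ≡ a * (b - c)
    factor = solve-∀

  ∣-sum-cut : ∀ {d} Q φ → (∀ {v} → v ∈ Q → d ∣ net φ v) → d ∣ sum λ e → φ e * cross Q e
  ∣-sum-cut {d} Q φ d∣net = subst (d ∣_) (net-cut Q φ) (∣-sum term)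
    where
    term : ∀ v → d ∣ 𝟙 Q v * net φ v
    term v with v ∈? Q
    ... | yes v∈Q = ∣n⇒∣m*n 1ℤ (d∣net v∈Q)
    ... | no  _   = divides 0ℤ refl

  -- Kirchhoff's law at all vertices of Q but one, and across the cut, gives it at the last one.
  ∣-net-last : ∀ {d} Q φ {u} → u ∈ Q → (∀ {v} → v ∈ Q → v ≢ u → d ∣ net φ v) →
               d ∣ sum (λ e → φ e * cross Q e) → d ∣ net φ u
  ∣-net-last {d} Q φ {u} u∈Q others d∣cut =
    subst (d ∣_) (trans (cong (_-_ total) rest) (cancel total (net φ u)))
      (∣m∣n⇒∣m-n (subst (d ∣_) (sym (net-cut Q φ)) d∣cut) (∣-sum term))
    where
    total = sum λ v → 𝟙 Q v * net φ v
    deficit : Vertex → ℤ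
    deficit v = 𝟙 Q v * net φ v + - net φ u * δ u v
    rest : sum deficit ≡ total + - net φ u
    rest = trans (∑-distrib-+ (λ v → 𝟙 Q v * net φ v) (λ v → - net φ u * δ u v))
                 (cong (_+_ total) (sum-δ u λ _ → - net φ u))
    cancel : ∀ a b → a - (a + - b) ≡ b
    cancel = solve-∀
    term : ∀ v → d ∣ deficit v
    term v with u ≟ᶠ v | v ∈? Q
    ... | yes refl | yes _   = divides 0ℤ (lemma (net φ u))
      where
      lemma : ∀ a → 1ℤ * a + - a * 1ℤ ≡ 0ℤ
      lemma = solve-∀
    ... | yes refl | no u∉Q  = contradiction u∈Q u∉Q
    ... | no  u≢v  | yes v∈Q = subst (d ∣_) (lemma (net φ v) (net φ u)) (others v∈Q (u≢v ∘ sym))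
      where
      lemma : ∀ a b → a ≡ 1ℤ * a + - b * 0ℤ
      lemma = solve-∀
    ... | no  u≢v  | no  _   = divides 0ℤ (lemma (net φ v) (net φ u))
      where
      lemma : ∀ a b → 0ℤ * a + - b * 0ℤ ≡ 0ℤ
      lemma = solve-∀

  -- If `e` alone left `Q`, membership in `Q` would be constant along walks avoiding `e`, so
  -- deleting `e` would separate its ends.
  bridgeless-cut : Bridgeless G → ∀ Q {e} → Leaves Q e → ∃[ f ] f ≢ e × Leaves Q f
  bridgeless-cut bridgeless Q {e} e-leaves
    with any? (λ f → ¬? (f ≟ᶠ e) ×-dec leaves? Q f)
  ... | yes found = found
  ... | no  alone = contradiction
    (tail e , head e , return (e , _ , refl , refl) , disconnected e-leaves) (bridgeless e)
    where
    constant : ∀ {u v} → Connected G (_≢ e) u v → 𝟙 Q u ≡ 𝟙 Q v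
    constant = gfold isEquivalence (𝟙 Q)
      λ { (f , f≢e , refl , refl) →
          i-j≡0⇒i≡j _ _ (cross-stays λ f-leaves → alone (f , f≢e , f-leaves)) }
    1≢0 : ∀ {m n} → m ≡ 1ℤ → n ≡ 0ℤ → m ≢ n
    1≢0 refl refl ()
    disconnected : Leaves Q e → ¬ Connected G (_≢ e) (tail e) (head e)
    disconnected (true  , s , t) c = 1≢0 (𝟙-∈ s) (𝟙-∉ t) (constant c)
    disconnected (false , s , t) c = 1≢0 (𝟙-∈ s) (𝟙-∉ t) (sym (constant c))

  -- Reachability along allowed arcs, with path flows

  Along : (Edge → Bool → Set) → Subset #V → Edge → ℤ → Set
  Along A R e k = k ≡ 0ℤ ⊎ ∃[ b ] k ≡ sgn b × A e b × src e b ∈ R × tgt e b ∈ R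

  Path : (Edge → Bool → Set) → Subset #V → Vertex → Vertex → Set
  Path A R x v = Σ[ p ∈ (Edge → ℤ) ] (∀ e → Along A R e (p e)) × (∀ w → net p w ≡ δ x w - δ v w)

  record Reach (A : Edge → Bool → Set) (I : Subset #V) (x : Vertex) : Set where
    field
      R      : Subset #V
      x∈R    : x ∈ R
      R⊆I    : R ⊆ I
      path   : ∀ {v} → v ∈ R → Path A R x v
      closed : ∀ e b → A e b → src e b ∈ R → tgt e b ∈ R

  along-mono : ∀ {A R R′} → R ⊆ R′ → ∀ {e k} → Along A R e k → Along A R′ e k
  along-mono R⊆R′ = map₂ λ (b , k≡ , a , s , t) → b , k≡ , a , R⊆R′ s , R⊆R′ t

  path-extend : ∀ {A R x e b} → A e b → src e b ∈ R → tgt e b ∉ R →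
                Path A R x (src e b) → Path A (R ∪ ⁅ tgt e b ⁆) x (tgt e b)
  path-extend {A} {R} {x} {e} {b} a s∈R t∉R (p , along , net-p) = p′ , along′ , net-p′
    where
    p′ : Edge → ℤ
    p′ h = p h + sgn b * δ e h
    -- Edges used by the path have both ends in `R`, whereas the new arc ends outside `R`.
    unused : p e ≡ 0ℤ
    unused with along e
    ... | inj₁ p≡0 = p≡0
    ... | inj₂ (b′ , _ , _ , s′ , t′) = contradiction (tgt∈R b b′ s′ t′) t∉R
      where
      tgt∈R : ∀ b b′ → src e b′ ∈ R → tgt e b′ ∈ R → tgt e b ∈ R
      tgt∈R true  true  s t = t
      tgt∈R true  false s t = s
      tgt∈R false true  s t = s
      tgt∈R false false s t = t
    along′ : ∀ h → Along A (R ∪ ⁅ tgt e b ⁆) h (p′ h)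
    along′ h with e ≟ᶠ h
    ... | yes refl = inj₂ (b , trans (cong₂ _+_ unused (*-identityʳ (sgn b))) (+-identityˡ _) , a ,
                           p⊆p∪q _ s∈R , q⊆p∪q R _ (x∈⁅x⁆ _))
    ... | no  _    = subst (Along A _ h) (lemma (p h) (sgn b)) (along-mono {A} (p⊆p∪q _) (along h))
      where
      lemma : ∀ i j → i ≡ i + j * 0ℤ
      lemma = solve-∀
    net-p′ : ∀ w → net p′ w ≡ δ x w - δ (tgt e b) w
    net-p′ w = begin
      net p′ w
        ≡⟨ net-+ p (λ h → sgn b * δ e h) w ⟩
      net p w + net (λ h → sgn b * δ e h) w
        ≡⟨ cong₂ _+_ (net-p w) (trans (net-δ (sgn b) e w) (inc-arc e b w)) ⟩
      δ x w - δ (src e b) w + (δ (src e b) w - δ (tgt e b) w)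
        ≡⟨ telescope (δ x w) (δ (src e b) w) (δ (tgt e b) w) ⟩
      δ x w - δ (tgt e b) w ∎
      where
      open ≡-Reasoning
      telescope : ∀ i j k → i - j + (j - k) ≡ i - k
      telescope = solve-∀

  -- The set grows by the target of one leaving arc at a time until it is closed, and the path to
  -- the new vertex extends one already found. Finiteness gives termination.
  reach : ∀ {A I x} → (∀ e b → Dec (A e b)) → (∀ {e b} → A e b → tgt e b ∈ I) → x ∈ I → Reach A I x
  reach {A} {I} {x} A? A⊆I x∈I =
    grow (x∈⁅x⁆ x) (λ v∈ → subst (_∈ I) (sym (x∈⁅y⁆⇒x≡y x v∈)) x∈I)
         (λ v∈ → subst (Path A _ x) (sym (x∈⁅y⁆⇒x≡y x v∈)) trivial) (⊃-wellFounded ⁅ x ⁆)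
    where
    trivial : Path A ⁅ x ⁆ x x
    trivial = (λ _ → 0ℤ) , (λ _ → inj₁ refl) ,
              λ w → trans (net-zero w λ _ → inj₂ refl) (sym (+-inverseʳ (δ x w)))
    grow : ∀ {R} → x ∈ R → R ⊆ I → (∀ {v} → v ∈ R → Path A R x v) → Acc (λ p q → q ⊂ p) R →
           Reach A I x
    grow {R} x∈R R⊆I path (acc rec)
      with any? (λ e → ∃Bool? λ b → A? e b ×-dec (src e b ∈? R) ×-dec ¬? (tgt e b ∈? R))
    ... | no  done = record
      { R = R ; x∈R = x∈R ; R⊆I = R⊆I ; path = path ; closed = closed }
      where
      closed : ∀ e b → A e b → src e b ∈ R → tgt e b ∈ R
      closed e b a s∈R with tgt e b ∈? R
      ... | yes t∈R = t∈R
      ... | no  t∉R = contradiction (e , b , a , s∈R , t∉R) done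
    ... | yes (e , b , a , s∈R , t∉R) =
      grow (p⊆p∪q _ x∈R) R′⊆I path′ (rec (p⊆p∪q _ , tgt e b , q⊆p∪q R _ (x∈⁅x⁆ _) , t∉R))
      where
      R′⊆I : R ∪ ⁅ tgt e b ⁆ ⊆ I
      R′⊆I v∈ with x∈p∪q⁻ R _ v∈
      ... | inj₁ v∈R = R⊆I v∈R
      ... | inj₂ v∈t = subst (_∈ I) (sym (x∈⁅y⁆⇒x≡y _ v∈t)) (A⊆I a)
      path′ : ∀ {v} → v ∈ R ∪ ⁅ tgt e b ⁆ → Path A (R ∪ ⁅ tgt e b ⁆) x v
      path′ v∈ with x∈p∪q⁻ R _ v∈
      ... | inj₁ v∈R = let p , along , net-p = path v∈R in
                       p , (λ h → along-mono {A} (p⊆p∪q _) (along h)) , net-p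
      ... | inj₂ v∈t = subst (Path A _ x) (sym (x∈⁅y⁆⇒x≡y _ v∈t)) (path-extend {A} {x = x} a s∈R t∉R (path s∈R))

  -- Augmenting paths

  -- A flow of value `k` with unit capacities. For `k = 2` every net outflow is even, so the support
  -- is the even subgraph that will carry `α`. If `x` and `y` coincide, the zero flow qualifies and
  -- the subgraph can be a single vertex.
  record UnitFlow (L : Subset #V) (x y : Vertex) (k : ℤ) : Set where
    field
      g       : Edge → ℤ
      unit    : ∀ e → g e ≡ 0ℤ ⊎ ∃[ b ] g e ≡ sgn b
      inside  : ∀ e → g e ≢ 0ℤ → ∀ b → src e b ∈ L
      balance : ∀ w → net g w ≡ k * (δ x w - δ y w)

  unit-flow-cut : ∀ {L x y k} (flow : UnitFlow L x y k) → let open UnitFlow flow in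
                  ∀ Q → sum (λ e → g e * cross Q e) ≡ k * 𝟙 Q x - k * 𝟙 Q y
  unit-flow-cut {x = x} {y} {k} flow Q = begin
    sum (λ e → g e * cross Q e)
      ≡⟨ net-cut Q g ⟨
    sum (λ v → 𝟙 Q v * net g v)
      ≡⟨ sum-cong-≗ (λ v → trans (cong (𝟙 Q v *_) (balance v)) (swap (𝟙 Q v) k _)) ⟩
    sum (λ v → k * 𝟙 Q v * (δ x v - δ y v))
      ≡⟨ sum-δ-δ x y (λ v → k * 𝟙 Q v) ⟩
    k * 𝟙 Q x - k * 𝟙 Q y ∎
    where
    open UnitFlow flow
    open ≡-Reasoning
    swap : ∀ a b c → a * (b * c) ≡ b * a * c
    swap = solve-∀

  Between : Subset #V → Subset #V → Edge → Set
  Between R L e = ∃[ b ] src e b ∈ R × tgt e b ∈ L × tgt e b ∉ R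

  record SmallCut (L : Subset #V) (x y : Vertex) : Set where
    field
      R       : Subset #V
      R⊆L     : R ⊆ L
      x∈R     : x ∈ R
      y∉R     : y ∉ R
      between : AtMostOne (Between R L)

  tgt-src : ∀ e {P : Vertex → Set} → (∀ b → P (src e b)) → ∀ b → P (tgt e b)
  tgt-src e p true  = p false
  tgt-src e p false = p true

  -- One Ford-Fulkerson step. If `y` is reachable in the residual graph, one more unit is pushed
  -- along a path. Otherwise every edge of `L` leaving the reachable set is saturated and
  -- contributes 1 to the value `k`, so there is at most one.
  augment : ∀ {L x y k} → x ∈ L → k ≤ 1ℤ → UnitFlow L x y k → UnitFlow L x y (k + 1ℤ) ⊎ SmallCut L x y
  augment {L} {x} {y} {k} x∈L k≤1 flow = conclude (y ∈? R)
    where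
    open UnitFlow flow
    -- Each edge has capacity one in both directions, so an arc is blocked only if `g` already uses
    -- it in that direction.
    Residual : Edge → Bool → Set
    Residual e b = src e b ∈ L × tgt e b ∈ L × g e ≢ sgn b
    open Reach (reach {Residual} {L} (λ e b → (src e b ∈? L) ×-dec (tgt e b ∈? L) ×-dec ¬? (g e ≟ᶻ sgn b))
                      (proj₁ ∘ proj₂) x∈L) renaming (R⊆I to R⊆L)

    excess : Edge → ℤ
    excess e = g e * cross R e

    saturated : ∀ {e} → Between R L e → excess e ≡ 1ℤ
    saturated {e} (b , s∈R , t∈L , t∉R) with g e ≟ᶻ sgn b
    ... | yes g≡b = trans (cong₂ _*_ g≡b (cross-leaves b s∈R t∉R)) (sgn-square b)
    ... | no  g≢b = contradiction (closed e b (R⊆L s∈R , t∈L , g≢b) s∈R) t∉R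

    excess≥0 : ∀ e → 0ℤ ≤ excess e
    excess≥0 e with leaves? R e
    ... | no stays = ≤-reflexive (sym (trans (cong (g e *_) (cross-stays stays)) (*-zeroʳ (g e))))
    ... | yes (b , s∈R , t∉R) with tgt e b ∈? L
    ...   | yes t∈L = subst (0ℤ ≤_) (sym (saturated (b , s∈R , t∈L , t∉R))) (+≤+ ℕ.z≤n)
    -- Flow stays inside `L`, so an edge leaving `L` carries none.
    ...   | no  t∉L with g e ≟ᶻ 0ℤ
    ...     | yes g≡0 = ≤-reflexive (sym (trans (cong (_* cross R e) g≡0) (*-zeroˡ (cross R e))))
    ...     | no  g≢0 = contradiction (tgt-src e {_∈ L} (inside e g≢0) b) t∉L

    total : y ∉ R → sum excess ≡ k
    total y∉R = begin
      sum excess             ≡⟨ unit-flow-cut flow R ⟩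
      k * 𝟙 R x - k * 𝟙 R y  ≡⟨ cong₂ (λ i j → k * i - k * j) (𝟙-∈ x∈R) (𝟙-∉ y∉R) ⟩
      k * 1ℤ - k * 0ℤ        ≡⟨ simplify k ⟩
      k                      ∎
      where
      open ≡-Reasoning
      simplify : ∀ a → a * 1ℤ - a * 0ℤ ≡ a
      simplify = solve-∀

    -- Two such edges would carry two units out of `R`, and no edge carries flow back, but the value
    -- is at most 1.
    between : y ∉ R → AtMostOne (Between R L)
    between y∉R {e} {f} e-btw f-btw with e ≟ᶠ f
    ... | yes e≡f = e≡f
    ... | no  e≢f = contradiction
      (≤ᶻ-trans (subst (_≤ sum excess) (cong₂ _+_ (saturated e-btw) (saturated f-btw))
                       (pair≤sum excess≥0 e f e≢f))
                (subst (_≤ 1ℤ) (sym (total y∉R)) k≤1))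
      λ { (+≤+ (ℕ.s≤s ())) }

    conclude : Dec (y ∈ R) → UnitFlow L x y (k + 1ℤ) ⊎ SmallCut L x y
    conclude (no y∉R) = inj₂ record
      { R = R ; R⊆L = R⊆L ; x∈R = x∈R ; y∉R = y∉R ; between = between y∉R }
    conclude (yes y∈R) with path y∈R
    ... | p , along , net-p = inj₁ record
      { g = λ e → g e + p e ; unit = unit′ ; inside = inside′ ; balance = balance′ }
      where
      -- Arcs of the path are residual, so where the path meets the support of `g` it runs against
      -- the flow and the two units cancel.
      cancel : ∀ b b′ → sgn b ≢ sgn b′ → sgn b + sgn b′ ≡ 0ℤ
      cancel true  true  neq = contradiction refl neq
      cancel true  false neq = refl
      cancel false true  neq = refl
      cancel false false neq = contradiction refl neq
      unit′ : ∀ e → g e + p e ≡ 0ℤ ⊎ ∃[ b ] g e + p e ≡ sgn b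
      unit′ e with along e
      ... | inj₁ p≡0 rewrite p≡0 | +-identityʳ (g e) = unit e
      ... | inj₂ (b , p≡b , (_ , _ , g≢b) , _) with unit e
      ...   | inj₁ g≡0 = inj₂ (b , trans (cong₂ _+_ g≡0 p≡b) (+-identityˡ _))
      ...   | inj₂ (b′ , g≡b′) =
        inj₁ (trans (cong₂ _+_ g≡b′ p≡b) (cancel b′ b λ eq → g≢b (trans g≡b′ eq)))
      both : ∀ {e} b → src e b ∈ L → tgt e b ∈ L → ∀ b′ → src e b′ ∈ L
      both true  s t true  = s
      both true  s t false = t
      both false s t true  = t
      both false s t false = s
      inside′ : ∀ e → g e + p e ≢ 0ℤ → ∀ b → src e b ∈ L
      inside′ e sum≢0 with along e
      ... | inj₁ p≡0 = inside e λ g≡0 → sum≢0 (cong₂ _+_ g≡0 p≡0)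
      ... | inj₂ (b , _ , (s , t , _) , _) = both b s t
      balance′ : ∀ w → net (λ e → g e + p e) w ≡ (k + 1ℤ) * (δ x w - δ y w)
      balance′ w = trans (net-+ g p w) (trans (cong₂ _+_ (balance w) (net-p w))
                                              (distrib k (δ x w - δ y w)))
        where
        distrib : ∀ a b → a * b + b ≡ (a + 1ℤ) * b
        distrib = solve-∀

  -- Menger's theorem for two edge-disjoint paths inside `L`, by augmenting the zero flow twice.
  two-flow : ∀ {L x y} → x ∈ L → UnitFlow L x y (+ 2) ⊎ SmallCut L x y
  two-flow {L} {x} {y} x∈L with augment x∈L (+≤+ ℕ.z≤n) zero-flow
    where
    zero-flow : UnitFlow L x y 0ℤ
    zero-flow = record
      { g       = λ _ → 0ℤ
      ; unit    = λ _ → inj₁ refl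
      ; inside  = λ _ 0≢0 → contradiction refl 0≢0
      ; balance = λ w → trans (net-zero w λ _ → inj₂ refl) (sym (*-zeroˡ (δ x w - δ y w)))
      }
  ... | inj₂ cut  = inj₂ cut
  ... | inj₁ flow = augment x∈L ≤ᶻ-refl flow

  -- Choosing what to absorb

  Exit Attach : Subset #V → Subset #V → Edge → Set
  Exit   Z L e = ∃[ b ] src e b ∈ L × tgt e b ∉ L × tgt e b ∉ Z
  Attach Z L e = ∃[ b ] src e b ∈ L × tgt e b ∈ Z

  -- The bound on exits is the invariant of the search: the whole complement of `Z` has none, and
  -- cutting a lobe along a small cut yields a lobe again.
  record Lobe (Z L : Subset #V) : Set where
    field
      disjoint : ∀ {v} → v ∈ L → v ∉ Z
      exit     : AtMostOne (Exit Z L)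

  -- In the pendant case at most two edges leave `L`, one to `Z` and one exit. In the other case two
  -- edges to `Z` come with a flow between their ends in `L`, whose support supplies the even
  -- subgraph.
  data Choice (Z : Subset #V) : Set where
    pendant : ∀ {L u} → u ∈ L → Lobe Z L → AtMostOne (Attach Z L) → Choice Z
    ear     : ∀ {L e f} a b → Lobe Z L → e ≢ f →
              src e a ∈ L → tgt e a ∈ Z → src f b ∈ L → tgt f b ∈ Z →
              UnitFlow L (src e a) (src f b) (+ 2) → Choice Z

  -- At most one edge exits L, so it ends in at most one of the two sides of the cut;
  -- the other side is a smaller lobe.
  smaller-lobe : ∀ {Z L x y} → y ∈ L → Lobe Z L → SmallCut L x y →
                 ∃[ L′ ] ∃[ u ] u ∈ L′ × Lobe Z L′ × L′ ⊂ L
  smaller-lobe {Z} {L} {x} {y} y∈L lobe cut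
    with any? (λ e → ∃Bool? λ b →
                 (src e b ∈? R) ×-dec ¬? (tgt e b ∈? L) ×-dec ¬? (tgt e b ∈? Z))
    where open SmallCut cut
  ... | no none = R , x , x∈R , record { disjoint = disjoint ∘ R⊆L ; exit = exit′ } ,
                  R⊆L , y , y∈L , y∉R
    where
    open Lobe lobe
    open SmallCut cut
    to-between : ∀ {e} → Exit Z R e → Between R L e
    to-between {e} (b , s∈R , t∉R , t∉Z) with tgt e b ∈? L
    ... | yes t∈L = b , s∈R , t∈L , t∉R
    ... | no  t∉L = contradiction (e , b , s∈R , t∉L , t∉Z) none
    exit′ : AtMostOne (Exit Z R)
    exit′ p q = between (to-between p) (to-between q)
  ... | yes (e₀ , b₀ , s₀∈R , t₀∉L , t₀∉Z) =
    L ∩ ∁ R , y , x∈p∩q⁺ (y∈L , x∉p⇒x∈∁p y∉R) ,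
    record { disjoint = disjoint ∘ p∩q⊆p L _ ; exit = exit′ } ,
    p∩q⊆p L _ , x , R⊆L x∈R , λ x∈ → x∈∁p⇒x∉p (proj₂ (x∈p∩q⁻ L _ x∈)) x∈R
    where
    open Lobe lobe
    open SmallCut cut
    other-end : ∀ b b₀ → src e₀ b ∈ L → src e₀ b ∉ R → src e₀ b₀ ∈ R → tgt e₀ b₀ ∈ L
    other-end true  true  s s∉R s∈R = contradiction s∈R s∉R
    other-end true  false s s∉R s∈R = s
    other-end false true  s s∉R s∈R = s
    other-end false false s s∉R s∈R = contradiction s∈R s∉R
    flip : ∀ {e} b → src e b ∈ L → src e b ∉ R → tgt e b ∈ R → Between R L e
    flip true  s s∉R t∈R = false , t∈R , s , s∉R
    flip false s s∉R t∈R = true  , t∈R , s , s∉R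
    to-between : ∀ {e} → Exit Z (L ∩ ∁ R) e → Between R L e
    to-between {e} (b , s∈ , t∉ , t∉Z) with x∈p∩q⁻ L _ s∈ | tgt e b ∈? L | tgt e b ∈? R
    ... | s∈L , s∈∁R | yes t∈L | yes t∈R = flip b s∈L (x∈∁p⇒x∉p s∈∁R) t∈R
    ... | s∈L , s∈∁R | yes t∈L | no  t∉R = contradiction (x∈p∩q⁺ (t∈L , x∉p⇒x∈∁p t∉R)) t∉
    -- An edge going out of `L` would be the unique exit `e₀`, which has one end in `R` and the
    -- other outside `L`, hence none in `L ∩ ∁ R`.
    ... | s∈L , s∈∁R | no  t∉L | _
      with refl ← exit (b , s∈L , t∉L , t∉Z) (b₀ , R⊆L s₀∈R , t₀∉L , t₀∉Z) =
      contradiction (other-end b b₀ s∈L (x∈∁p⇒x∉p s∈∁R) s₀∈R) t₀∉L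
    exit′ : AtMostOne (Exit Z (L ∩ ∁ R))
    exit′ p q = between (to-between p) (to-between q)

  -- When two edges join `L` to `Z`, a flow of value 2 between their ends in `L` gives an ear.
  -- Failing that, the small cut yields a strictly smaller lobe, in which the search continues.
  choose : ∀ {Z L u} → u ∈ L → Lobe Z L → Acc _⊂_ L → Choice Z
  choose {Z} {L} {u} u∈L lobe (acc rec)
    with any? (λ e → any? λ f → ¬? (e ≟ᶠ f) ×-dec attach? e ×-dec attach? f)
    where
    attach? : ∀ e → Dec (Attach Z L e)
    attach? e = ∃Bool? λ b → (src e b ∈? L) ×-dec (tgt e b ∈? Z)
  ... | yes (e , f , e≢f , (a , s∈L , s∈Z) , (b , t∈L , t∈Z)) with two-flow {L} {src e a} {src f b} s∈L
  ...   | inj₁ flow = ear a b lobe e≢f s∈L s∈Z t∈L t∈Z flow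
  ...   | inj₂ cut  = let L′ , u′ , u′∈L′ , lobe′ , L′⊂L = smaller-lobe t∈L lobe cut in
                      choose u′∈L′ lobe′ (rec L′⊂L)
  choose {Z} {L} u∈L lobe (acc rec) | no none = pendant u∈L lobe attach
    where
    attach : AtMostOne (Attach Z L)
    attach {e} {f} p q with e ≟ᶠ f
    ... | yes e≡f = e≡f
    ... | no  e≢f = contradiction (e , f , e≢f , p , q) none

  -- Flows on the graph in which Z is contracted

  NonZero₂₃ : ℤ → ℤ → Set
  NonZero₂₃ a b = ¬ + 2 ∣ a ⊎ ¬ + 3 ∣ b

  -- Integer representatives of residues modulo 2 and 3, with balance asked only outside the
  -- contracted set. Because `α` vanishes on edges touching `Z`, `β` is nonzero modulo 3 there,
  -- which makes edges to `Z` available for corrections.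
  record Solution (Z : Subset #V) : Set where
    field
      α β  : Edge → ℤ
      nz   : ∀ e → NonZero₂₃ (α e) (β e)
      α-Z  : ∀ e b → src e b ∈ Z → α e ≡ 0ℤ
      α-bal : ∀ {v} → v ∉ Z → + 2 ∣ net α v
      β-bal : ∀ {v} → v ∉ Z → + 3 ∣ net β v

  β-nz : ∀ {Z} (S : Solution Z) → let open Solution S in ∀ {e} → α e ≡ 0ℤ → ¬ + 3 ∣ β e
  β-nz S {e} α≡0 with Solution.nz S e
  ... | inj₁ 2∤α = contradiction (divides 0ℤ α≡0) 2∤α
  ... | inj₂ 3∤β = 3∤β

  -- Passing from a larger contracted set to a smaller one

  touching-zero : ∀ {φ} v → (∀ e b → src e b ≡ v → φ e ≡ 0ℤ) → net φ v ≡ 0ℤ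
  touching-zero {φ} v φ≡0 = net-zero v off-or-zero
    where
    off-or-zero : ∀ e → inc e v ≡ 0ℤ ⊎ φ e ≡ 0ℤ
    off-or-zero e with tail e ≟ᶠ v | head e ≟ᶠ v
    ... | yes t | _     = inj₂ (φ≡0 e true t)
    ... | no  _ | yes h = inj₂ (φ≡0 e false h)
    ... | no  _ | no  _ = inj₁ refl

  src-of-tgt : ∀ e b {P : Vertex → Set} → P (tgt e b) → ∃[ b′ ] P (src e b′)
  src-of-tgt e true  p = false , p
  src-of-tgt e false p = true , p

  α-tgt : ∀ {Z} (S : Solution Z) → let open Solution S in ∀ e b → tgt e b ∈ Z → α e ≡ 0ℤ
  α-tgt {Z} S e b t∈Z = let b′ , s∈Z = src-of-tgt e b {_∈ Z} t∈Z in Solution.α-Z S e b′ s∈Z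

  -- The one vertex at issue is `u`, and `α` vanishes on all edges at `u`.
  α-bal-∪ : ∀ {Z u} (S : Solution (Z ∪ ⁅ u ⁆)) → let open Solution S in
            ∀ {v} → v ∉ Z → + 2 ∣ net α v
  α-bal-∪ {Z} {u} S {v} v∉Z with u ≟ᶠ v
  ... | yes refl = divides 0ℤ (touching-zero u λ e b s≡u → Solution.α-Z S e b
                                 (subst (_∈ Z ∪ ⁅ u ⁆) (sym s≡u) (q⊆p∪q Z _ (x∈⁅x⁆ u))))
  ... | no  u≢v  = Solution.α-bal S λ v∈ →
    [ v∉Z , (λ v∈u → u≢v (sym (x∈⁅y⁆⇒x≡y u v∈u))) ]′ (x∈p∪q⁻ Z _ v∈)

  ∉-∪-single : ∀ {Z : Subset #V} {u v} → v ∉ Z → v ≢ u → v ∉ Z ∪ ⁅ u ⁆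
  ∉-∪-single {Z} {u} v∉Z v≢u v∈ = [ v∉Z , v≢u ∘ x∈⁅y⁆⇒x≡y u ]′ (x∈p∪q⁻ Z _ v∈)

  -- An edge leaving `L` would be an exit, and bridgelessness would supply a second one; so no edge
  -- leaves `L`. Balance of `β` at `u` then follows from balance at the other vertices of `L`.
  absorb-unattached : Bridgeless G → ∀ {Z L u} → u ∈ L → Lobe Z L → (∀ e → ¬ Attach Z L e) →
                      Solution (Z ∪ ⁅ u ⁆) → Solution Z
  absorb-unattached bridgeless {Z} {L} {u} u∈L lobe unattached S = record
    { α = α ; β = β ; nz = nz
    ; α-Z = λ e b s∈Z → α-Z e b (p⊆p∪q _ s∈Z)
    ; α-bal = α-bal-∪ S ; β-bal = β-bal′ }
    where
    open Lobe lobe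
    open Solution S
    no-leaving : ∀ e → ¬ Leaves L e
    no-leaving e e-leaves with f , f≢e , f-leaves ← bridgeless-cut bridgeless L e-leaves =
      f≢e (exit (exits f-leaves) (exits e-leaves))
      where
      exits : ∀ {h} → Leaves L h → Exit Z L h
      exits {h} (b , s∈L , t∉L) = b , s∈L , t∉L , λ t∈Z → unattached h (b , s∈L , t∈Z)
    β-bal′ : ∀ {v} → v ∉ Z → + 3 ∣ net β v
    β-bal′ {v} v∉Z with v ≟ᶠ u
    ... | no  v≢u  = β-bal (∉-∪-single v∉Z v≢u)
    ... | yes refl = ∣-net-last L β u∈L
      (λ w∈L w≢u → β-bal (∉-∪-single (disjoint w∈L) w≢u))
      (divides 0ℤ (sum-zero λ e → trans (cong (β e *_) (cross-stays (no-leaving e))) (*-zeroʳ (β e))))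

  -- L is left by exactly two edges, e and f, so Kirchhoff's law on L makes the values on e and f
  -- agree up to sign modulo 2 and 3.
  absorb-pendant : Bridgeless G → ∀ {Z L e} a → src e a ∈ L → tgt e a ∈ Z → Lobe Z L →
                   AtMostOne (Attach Z L) → Solution (Z ∪ ⁅ src e a ⁆) → Solution Z
  absorb-pendant bridgeless {Z} {L} {e} a u∈L t∈Z lobe attach S = record
    { α = α ; β = β′ ; nz = nz′
    ; α-Z = λ e b s∈Z → α-Z e b (p⊆p∪q _ s∈Z)
    ; α-bal = α-bal-∪ S ; β-bal = β-bal′ }
    where
    open Lobe lobe
    open Solution S
    u = src e a
    t∉L : tgt e a ∉ L
    t∉L t∈L = disjoint t∈L t∈Z
    e-attach : Attach Z L e
    e-attach = a , u∈L , t∈Z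

    other : ∃[ f ] f ≢ e × Leaves L f
    other = bridgeless-cut bridgeless L (a , u∈L , t∉L)
    f = proj₁ other
    f≢e : f ≢ e
    f≢e = proj₁ (proj₂ other)

    attach-or-exit : ∀ {h} → Leaves L h → Attach Z L h ⊎ Exit Z L h
    attach-or-exit {h} (b , s∈L , t∉L) with tgt h b ∈? Z
    ... | yes t∈Z = inj₁ (b , s∈L , t∈Z)
    ... | no  t∉Z = inj₂ (b , s∈L , t∉L , t∉Z)
    f-exit : Exit Z L f
    f-exit = [ (λ f-attach → contradiction (attach f-attach e-attach) f≢e) , (λ z → z) ]′
               (attach-or-exit (proj₂ (proj₂ other)))
    b = proj₁ f-exit

    cut-eq : ∀ φ → sum (λ h → φ h * cross L h) ≡ φ e * sgn a + φ f * sgn b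
    cut-eq φ = trans
      (sum-pair e f (f≢e ∘ sym) λ h h≢e h≢f →
        trans (cong (φ h *_) (cross-stays (stays h≢e h≢f))) (*-zeroʳ (φ h)))
      (cong₂ (λ i j → φ e * i + φ f * j)
        (cross-leaves a u∈L t∉L)
        (cross-leaves b (proj₁ (proj₂ f-exit)) (proj₁ (proj₂ (proj₂ f-exit)))))
      where
      stays : ∀ {h} → h ≢ e → h ≢ f → ¬ Leaves L h
      stays h≢e h≢f h-leaves with attach-or-exit h-leaves
      ... | inj₁ p = h≢e (attach p e-attach)
      ... | inj₂ q = h≢f (exit q f-exit)

    transfer : ∀ {d} φ → (∀ {v} → v ∈ L → d ∣ net φ v) → d ∣ φ e → d ∣ φ f
    transfer {d} φ d∣net d∣e = ∣-sgn b (subst (d ∣_) (cancel (φ e * sgn a) (φ f * sgn b))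
      (∣m∣n⇒∣m-n (subst (d ∣_) (cut-eq φ) (∣-sum-cut L φ d∣net)) (∣m⇒∣m*n (sgn a) d∣e)))
      where
      cancel : ∀ i j → i + j - i ≡ j
      cancel = solve-∀

    -- The change on `e` that cancels the imbalance at `u`. The other end of `e` lies in `Z`, where
    -- no balance is required.
    c = - (sgn a * net β u)
    β′ : Edge → ℤ
    β′ h = β h + c * δ e h

    net-β′ : ∀ v → net β′ v ≡ net β v + c * inc e v
    net-β′ v = trans (net-+ β (λ h → c * δ e h) v) (cong (_+_ (net β v)) (net-δ c e v))

    t≢ : ∀ {v} → v ∉ Z → tgt e a ≢ v
    t≢ v∉Z refl = v∉Z t∈Z

    β-bal′ : ∀ {v} → v ∉ Z → + 3 ∣ net β′ v
    β-bal′ {v} v∉Z with v ≟ᶠ u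
    ... | no  v≢u  = subst (+ 3 ∣_)
      (sym (trans (net-β′ v) (trans
        (cong (λ i → net β v + c * i) (inc-arc-off a (v≢u ∘ sym) (t≢ v∉Z)))
        (trans (cong (_+_ (net β v)) (*-zeroʳ c)) (+-identityʳ _)))))
      (β-bal (∉-∪-single v∉Z v≢u))
    ... | yes refl = divides 0ℤ (begin
      net β′ u
        ≡⟨ net-β′ u ⟩
      net β u + c * inc e u
        ≡⟨ regroup (sgn a) (net β u) (inc e u) ⟩
      net β u + - (net β u * (sgn a * inc e u))
        ≡⟨ cong (λ i → net β u + - (net β u * i)) (trans (inc-arc e a u)
             (cong₂ _-_ (δ-refl u) (δ-≢ (t≢ v∉Z)))) ⟩
      net β u + - (net β u * 1ℤ)
        ≡⟨ vanish (net β u) ⟩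
      0ℤ ∎)
      where
      open ≡-Reasoning
      regroup : ∀ s n i → n + - (s * n) * i ≡ n + - (n * (s * i))
      regroup = solve-∀
      vanish : ∀ n → n + - (n * 1ℤ) ≡ 0ℤ
      vanish = solve-∀

    α-e : α e ≡ 0ℤ
    α-e = α-Z e a (q⊆p∪q Z _ (x∈⁅x⁆ u))

    β′-f : β′ f ≡ β f
    β′-f = trans (cong (λ i → β f + c * i) (δ-≢ (f≢e ∘ sym)))
                 (trans (cong (_+_ (β f)) (*-zeroʳ c)) (+-identityʳ _))

    -- Otherwise both residues vanish on `e`, since `α e` is 0, and hence on `f`, against `nz f`.
    3∤β′e : ¬ + 3 ∣ β′ e
    3∤β′e 3∣β′e with nz f
    ... | inj₁ 2∤ = 2∤ (transfer α (λ v∈L → α-bal-∪ S (disjoint v∈L)) (divides 0ℤ α-e))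
    ... | inj₂ 3∤ = 3∤ (subst (+ 3 ∣_) β′-f (transfer β′ (λ v∈L → β-bal′ (disjoint v∈L)) 3∣β′e))

    nz′ : ∀ h → NonZero₂₃ (α h) (β′ h)
    nz′ h with e ≟ᶠ h
    ... | yes refl = inj₂ (subst (λ i → ¬ + 3 ∣ β e + c * i) (δ-refl e) 3∤β′e)
    ... | no  _    = subst (NonZero₂₃ (α h)) (lemma (β h) c) (nz h)
      where
      lemma : ∀ i j → i ≡ i + j * 0ℤ
      lemma = solve-∀

  Support : (Edge → ℤ) → Edge → Bool → Set
  Support g e _ = g e ≢ 0ℤ

  -- With Q the part of the support of g reachable from x, α becomes ±1 on the edges of g in Q,
  -- which leaves β free there; connectedness of Q then lets β be balanced inside Q once its
  -- values on the two edges e and f to Z balance it across the boundary of Q.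
  absorb-ear : ∀ {Z L e f} a b → Lobe Z L → e ≢ f →
               src e a ∈ L → tgt e a ∈ Z → src f b ∈ L → tgt f b ∈ Z →
               (flow : UnitFlow L (src e a) (src f b) (+ 2)) →
               (Q : Reach (Support (UnitFlow.g flow)) L (src e a)) →
               Solution (Z ∪ Reach.R Q) → Solution Z
  absorb-ear {Z} {L} {e} {f} a b lobe e≢f x∈L ea∈Z y∈L fb∈Z flow reached S = record
    { α = α′ ; β = β₂ ; nz = nz′ ; α-Z = α′-Z ; α-bal = α′-bal ; β-bal = β₂-bal }
    where
    open Lobe lobe
    open UnitFlow flow
    open Reach reached renaming (R to Q; x∈R to x∈Q; R⊆I to Q⊆L)
    open Solution S
    open ≡-Reasoning
    x = src e a
    y = src f b

    ∉Q : ∀ {v} → v ∈ Z → v ∉ Q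
    ∉Q v∈Z v∈Q = disjoint (Q⊆L v∈Q) v∈Z

    no-excess : ∀ h → g h * cross Q h ≡ 0ℤ
    no-excess h with g h ≟ᶻ 0ℤ
    ... | yes g≡0 = trans (cong (_* cross Q h) g≡0) (*-zeroˡ (cross Q h))
    ... | no  g≢0 = trans (cong (g h *_) (cross-stays λ (c , s , t) → t (closed h c g≢0 s)))
                          (*-zeroʳ (g h))

    -- The flow does not cross the boundary of `Q`, whereas separating `x` from `y` would require
    -- two units to cross it.
    y∈Q : y ∈ Q
    y∈Q with y ∈? Q
    ... | yes y∈Q = y∈Q
    ... | no  y∉Q = contradiction
      (trans (sym (sum-zero no-excess))
             (trans (unit-flow-cut flow Q)
                    (cong₂ (λ i j → + 2 * i - + 2 * j) (𝟙-∈ x∈Q) (𝟙-∉ y∉Q))))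
      λ ()

    -- On the support of `g` the tail is in `Q` exactly when the head is, so testing the tail is
    -- enough.
    α′ : Edge → ℤ
    α′ h = α h + 𝟙 Q (tail h) * g h

    α′-Z : ∀ h c → src h c ∈ Z → α′ h ≡ 0ℤ
    α′-Z h c s∈Z with g h ≟ᶻ 0ℤ
    ... | yes g≡0 = cong₂ _+_ (α-Z h c (p⊆p∪q _ s∈Z))
                              (trans (cong (𝟙 Q (tail h) *_) g≡0) (*-zeroʳ (𝟙 Q (tail h))))
    ... | no  g≢0 = contradiction s∈Z (disjoint (inside h g≢0 c))

    α′-bal : ∀ {v} → v ∉ Z → + 2 ∣ net α′ v
    α′-bal {v} v∉Z with v ∈? Q
    ... | yes v∈Q = subst (+ 2 ∣_)
      (sym (trans (net-+ α (λ h → 𝟙 Q (tail h) * g h) v)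
                  (cong₂ _+_ (touching-zero v λ h c s≡v → α-Z h c
                                (subst (_∈ Z ∪ Q) (sym s≡v) (q⊆p∪q Z Q v∈Q)))
                             (trans (net-cong v same) (balance v)))))
      (divides (δ x v - δ y v) (lemma (δ x v - δ y v)))
      where
      lemma : ∀ i → 0ℤ + + 2 * i ≡ i * + 2
      lemma = solve-∀
      same : ∀ h → inc h v ≡ 0ℤ ⊎ 𝟙 Q (tail h) * g h ≡ g h
      same h with tail h ∈? Q | g h ≟ᶻ 0ℤ
      ... | yes _   | _       = inj₂ (*-identityˡ (g h))
      ... | no  _   | yes g≡0 = inj₂ (sym g≡0)
      ... | no  t∉Q | no  g≢0 = inj₁ (inc-off (λ { refl → t∉Q v∈Q })
                                              (λ { refl → t∉Q (closed h false g≢0 v∈Q) }))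
    ... | no  v∉Q = subst (+ 2 ∣_)
      (sym (trans (net-+ α (λ h → 𝟙 Q (tail h) * g h) v)
                  (trans (cong (_+_ (net α v)) (net-zero v zero-at-v)) (+-identityʳ (net α v)))))
      (α-bal λ v∈ → [ v∉Z , v∉Q ]′ (x∈p∪q⁻ Z Q v∈))
      where
      zero-at-v : ∀ h → inc h v ≡ 0ℤ ⊎ 𝟙 Q (tail h) * g h ≡ 0ℤ
      zero-at-v h with tail h ∈? Q | g h ≟ᶻ 0ℤ
      ... | no  _   | _       = inj₂ (*-zeroˡ (g h))
      ... | yes _   | yes g≡0 = inj₂ (trans (*-identityˡ (g h)) g≡0)
      ... | yes t∈Q | no  g≢0 = inj₁ (inc-off (λ { refl → v∉Q t∈Q })
                                              (λ { refl → v∉Q (closed h true g≢0 t∈Q) }))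

    3∤βe : ¬ + 3 ∣ β e
    3∤βe = β-nz S (α-tgt S e a (p⊆p∪q _ ea∈Z))
    3∤βf : ¬ + 3 ∣ β f
    3∤βf = β-nz S (α-tgt S f b (p⊆p∪q _ fb∈Z))

    -- Unfolding the residues here would make the with-abstractions below explode.
    abstract
      boundary : ∃[ i ] ∃[ j ] Bit i × Bit j ×
                 + 3 ∣ sum (λ h → β h * cross Q h) + (i * (β e * cross Q e) + j * (β f * cross Q f))
      boundary = fix-mod3 (sum λ h → β h * cross Q h)
        (3∤βe ∘ ∣-sgn a ∘ subst (λ s → + 3 ∣ β e * s) (cross-leaves a x∈Q (∉Q ea∈Z)))
        (3∤βf ∘ ∣-sgn b ∘ subst (λ s → + 3 ∣ β f * s) (cross-leaves b y∈Q (∉Q fb∈Z)))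
    i = proj₁ boundary
    j = proj₁ (proj₂ boundary)
    i-bit = proj₁ (proj₂ (proj₂ boundary))
    j-bit = proj₁ (proj₂ (proj₂ (proj₂ boundary)))

    -- The values on `e` and `f` are kept or doubled. Both edges run from `Q` to `Z`, so outside `Z`
    -- the balance changes only in `Q`.
    change β₁ : Edge → ℤ
    change h = i * β e * δ e h + j * β f * δ f h
    β₁ h = β h + change h

    3∣cut : + 3 ∣ sum λ h → β₁ h * cross Q h
    3∣cut = subst (+ 3 ∣_) (sym eq) (proj₂ (proj₂ (proj₂ (proj₂ boundary))))
      where
      expand : ∀ p q r s t c → (p + (q * s + r * t)) * c ≡ p * c + (q * c * s + r * c * t)
      expand = solve-∀
      assoc : ∀ p q r → p * q * r ≡ p * (q * r)
      assoc = solve-∀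
      eq : sum (λ h → β₁ h * cross Q h) ≡
           sum (λ h → β h * cross Q h) + (i * (β e * cross Q e) + j * (β f * cross Q f))
      eq = begin
        sum (λ h → β₁ h * cross Q h)
          ≡⟨ sum-cong-≗ (λ h → expand (β h) (i * β e) (j * β f) (δ e h) (δ f h) (cross Q h)) ⟩
        sum (λ h → β h * cross Q h + (at-e h + at-f h))
          ≡⟨ trans (∑-distrib-+ (λ h → β h * cross Q h) (λ h → at-e h + at-f h))
                   (cong (_+_ (sum λ h → β h * cross Q h)) (∑-distrib-+ at-e at-f)) ⟩
        sum (λ h → β h * cross Q h) + (sum at-e + sum at-f)
          ≡⟨ cong (_+_ (sum λ h → β h * cross Q h)) (cong₂ _+_
               (trans (sum-δ e λ h → i * β e * cross Q h) (assoc i (β e) (cross Q e)))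
               (trans (sum-δ f λ h → j * β f * cross Q h) (assoc j (β f) (cross Q f)))) ⟩
        sum (λ h → β h * cross Q h) + (i * (β e * cross Q e) + j * (β f * cross Q f)) ∎
        where
        at-e at-f : Edge → ℤ
        at-e h = i * β e * cross Q h * δ e h
        at-f h = j * β f * cross Q h * δ f h

    -- The default outside `Q` is harmless, as `demand` vanishes there.
    route : ∀ {w} → Dec (w ∈ Q) → Edge → ℤ
    route (yes w∈Q) = proj₁ (path w∈Q)
    route (no  _)   = λ _ → 0ℤ

    demand : Vertex → ℤ
    demand w = 𝟙 Q w * net β₁ w

    -- Every imbalance in `Q` is moved to `x` along a path in the support of `g`. What accumulates
    -- at `x` is `total`, the sum across the cut, which is 0 modulo 3.
    β₂ : Edge → ℤ
    β₂ h = β₁ h + sum λ w → demand w * route (w ∈? Q) h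

    total : ℤ
    total = sum demand

    3∣total : + 3 ∣ total
    3∣total = subst (+ 3 ∣_) (sym (net-cut Q β₁)) 3∣cut

    net-β₂ : ∀ v → net β₂ v ≡ net β₁ v + (total * δ x v - demand v)
    net-β₂ v = begin
      net β₂ v
        ≡⟨ net-+ β₁ (λ h → sum λ w → demand w * route (w ∈? Q) h) v ⟩
      net β₁ v + net (λ h → sum λ w → demand w * route (w ∈? Q) h) v
        ≡⟨ cong (_+_ (net β₁ v)) (net-sum demand (λ w → route (w ∈? Q)) v) ⟩
      net β₁ v + sum (λ w → demand w * net (route (w ∈? Q)) v)
        ≡⟨ cong (_+_ (net β₁ v)) (sum-cong-≗ routed) ⟩
      net β₁ v + sum (λ w → δ x v * demand w + -1ℤ * (demand w * δ v w))
        ≡⟨ cong (_+_ (net β₁ v)) (trans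
             (∑-distrib-+ (λ w → δ x v * demand w) (λ w → -1ℤ * (demand w * δ v w)))
             (cong₂ _+_ (sum-scale (δ x v) demand)
               (trans (sum-scale -1ℤ λ w → demand w * δ v w) (cong (-1ℤ *_) (sum-δ v demand))))) ⟩
      net β₁ v + (δ x v * total + -1ℤ * demand v)
        ≡⟨ tidy (net β₁ v) (δ x v) total (demand v) ⟩
      net β₁ v + (total * δ x v - demand v) ∎
      where
      tidy : ∀ n d t c → n + (d * t + -1ℤ * c) ≡ n + (t * d - c)
      tidy = solve-∀
      expand : ∀ c d d′ → c * (d - d′) ≡ d * c + -1ℤ * (c * d′)
      expand = solve-∀
      routed : ∀ w → demand w * net (route (w ∈? Q)) v ≡ δ x v * demand w + -1ℤ * (demand w * δ v w)
      routed w with w ∈? Q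
      ... | yes w∈Q = trans (cong (1ℤ * net β₁ w *_)
                              (trans (proj₂ (proj₂ (path w∈Q)) v) (cong (_-_ (δ x v)) (δ-sym w v))))
                            (expand (1ℤ * net β₁ w) (δ x v) (δ v w))
      ... | no  _   = lemma (net β₁ w) (net (λ _ → 0ℤ) v) (δ x v) (δ v w)
        where
        lemma : ∀ n p q r → 0ℤ * n * p ≡ q * (0ℤ * n) + -1ℤ * (0ℤ * n * r)
        lemma = solve-∀

    β₂-bal : ∀ {v} → v ∉ Z → + 3 ∣ net β₂ v
    β₂-bal {v} v∉Z = subst (+ 3 ∣_) (sym (net-β₂ v)) balanced
      where
      balanced : + 3 ∣ net β₁ v + (total * δ x v - demand v)
      balanced with v ∈? Q
      ... | yes _ = subst (+ 3 ∣_) (lemma (net β₁ v) (total * δ x v)) (∣m⇒∣m*n (δ x v) 3∣total)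
        where
        lemma : ∀ n t → t ≡ n + (t - 1ℤ * n)
        lemma = solve-∀
      ... | no  v∉Q = subst (+ 3 ∣_)
        (trans (lemma (net β v) (total * δ x v) (net β₁ v))
               (cong (λ n → n + (total * δ x v - 0ℤ * net β₁ v)) (sym unchanged)))
        (∣m∣n⇒∣m+n (β-bal λ v∈ → [ v∉Z , v∉Q ]′ (x∈p∪q⁻ Z Q v∈)) (∣m⇒∣m*n (δ x v) 3∣total))
        where
        lemma : ∀ n t m → n + t ≡ n + (t - 0ℤ * m)
        lemma = solve-∀
        unchanged : net β₁ v ≡ net β v
        unchanged = net-cong v same
          where
          same : ∀ h → inc h v ≡ 0ℤ ⊎ β₁ h ≡ β h
          same h with e ≟ᶠ h | f ≟ᶠ h
          ... | yes refl | _ = inj₁ (inc-arc-off a (λ { refl → v∉Q x∈Q }) (λ { refl → v∉Z ea∈Z }))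
          ... | no _ | yes refl = inj₁ (inc-arc-off b (λ { refl → v∉Q y∈Q }) (λ { refl → v∉Z fb∈Z }))
          ... | no _ | no _ = inj₂ (vanish (β h) (i * β e) (j * β f))
            where
            vanish : ∀ n p q → n + (p * 0ℤ + q * 0ℤ) ≡ n
            vanish = solve-∀

    nz₁ : ∀ h → NonZero₂₃ (α h) (β₁ h)
    nz₁ h with e ≟ᶠ h | f ≟ᶠ h
    ... | yes refl | yes refl = contradiction refl e≢f
    ... | yes refl | no _ =
      inj₂ (3∤-double i-bit 3∤βe ∘ subst (+ 3 ∣_) (lemma (β e) (i * β e) (j * β f)))
      where
      lemma : ∀ n p q → n + (p * 1ℤ + q * 0ℤ) ≡ n + p
      lemma = solve-∀
    ... | no _ | yes refl =
      inj₂ (3∤-double j-bit 3∤βf ∘ subst (+ 3 ∣_) (lemma (β f) (i * β e) (j * β f)))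
      where
      lemma : ∀ n p q → n + (p * 0ℤ + q * 1ℤ) ≡ n + q
      lemma = solve-∀
    ... | no _ | no _ = subst (NonZero₂₃ (α h)) (lemma (β h) (i * β e) (j * β f)) (nz h)
      where
      lemma : ∀ n p q → n ≡ n + (p * 0ℤ + q * 0ℤ)
      lemma = solve-∀

    -- The routes use only edges of `g` inside `Q`, so elsewhere `α` and `β₁` are unaltered.
    nz-off : ∀ h → g h ≡ 0ℤ ⊎ tail h ∉ Q → NonZero₂₃ (α′ h) (β₂ h)
    nz-off h off = subst (λ n → NonZero₂₃ n (β₂ h)) (sym α′≡α)
                     (subst (NonZero₂₃ (α h)) (sym β₂≡β₁) (nz₁ h))
      where
      α′≡α : α′ h ≡ α h
      α′≡α = trans (cong (_+_ (α h)) ([ (λ g≡0 → trans (cong (𝟙 Q (tail h) *_) g≡0) (*-zeroʳ (𝟙 Q (tail h))))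
                                      , (λ t∉Q → trans (cong (_* g h) (𝟙-∉ t∉Q)) (*-zeroˡ (g h))) ]′ off))
                   (+-identityʳ (α h))
      unrouted : ∀ {w} (w? : Dec (w ∈ Q)) → route w? h ≡ 0ℤ
      unrouted (no  _)   = refl
      unrouted (yes w∈Q) with proj₁ (proj₂ (path w∈Q)) h
      ... | inj₁ p≡0 = p≡0
      ... | inj₂ (true  , _ , g≢0 , s , t) = ⊥-elim ([ g≢0 , (λ t∉Q → t∉Q s) ]′ off)
      ... | inj₂ (false , _ , g≢0 , s , t) = ⊥-elim ([ g≢0 , (λ t∉Q → t∉Q t) ]′ off)
      β₂≡β₁ : β₂ h ≡ β₁ h
      β₂≡β₁ = trans (cong (_+_ (β₁ h)) (sum-zero λ w →
                trans (cong (demand w *_) (unrouted (w ∈? Q))) (*-zeroʳ (demand w))))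
              (+-identityʳ (β₁ h))

    odd : ∀ {n} → n ≢ 0ℤ → n ≡ 0ℤ ⊎ (∃[ c ] n ≡ sgn c) → ¬ + 2 ∣ n
    odd n≢0 (inj₁ n≡0) _ = n≢0 n≡0
    odd n≢0 (inj₂ (true  , refl)) 2∣n = contradiction (∣⇒∣ᵤ 2∣n) (ℕ.>⇒∤ (ℕ.s≤s (ℕ.s≤s ℕ.z≤n)))
    odd n≢0 (inj₂ (false , refl)) 2∣n = contradiction (∣⇒∣ᵤ 2∣n) (ℕ.>⇒∤ (ℕ.s≤s (ℕ.s≤s ℕ.z≤n)))

    nz′ : ∀ h → NonZero₂₃ (α′ h) (β₂ h)
    nz′ h = by-cases (g h ≟ᶻ 0ℤ) (tail h ∈? Q)
      where
      by-cases : Dec (g h ≡ 0ℤ) → Dec (tail h ∈ Q) → NonZero₂₃ (α′ h) (β₂ h)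
      by-cases (yes g≡0) _         = nz-off h (inj₁ g≡0)
      by-cases (no  _)   (no  t∉Q) = nz-off h (inj₂ t∉Q)
      -- Here `α` vanishes because `Q` was contracted, so `α′` is the odd value of `g` and `β₂` may
      -- be anything.
      by-cases (no  g≢0) (yes t∈Q) = inj₁ (odd g≢0 (unit h) ∘ subst (+ 2 ∣_) α′≡g)
        where
        α′≡g : α′ h ≡ g h
        α′≡g = trans (cong₂ (λ m n → m + n * g h) (α-Z h true (q⊆p∪q Z Q t∈Q)) (𝟙-∈ t∈Q))
                     (trans (+-identityˡ _) (*-identityˡ (g h)))

  -- Induction on the contracted set

  absorb : Bridgeless G → ∀ {Z} → (∀ {Z′} → Z ⊂ Z′ → Solution Z′) → Choice Z → Solution Z
  absorb bridgeless {Z} larger (pendant {L} {u} u∈L lobe attach)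
    with any? (λ e → ∃Bool? λ b → (src e b ∈? L) ×-dec (tgt e b ∈? Z))
  ... | yes (e , a , s∈L , t∈Z) =
    absorb-pendant bridgeless a s∈L t∈Z lobe attach
      (larger (p⊆p∪q _ , src e a , q⊆p∪q Z _ (x∈⁅x⁆ _) , Lobe.disjoint lobe s∈L))
  ... | no unattached =
    absorb-unattached bridgeless u∈L lobe (λ { e (b , p) → unattached (e , b , p) })
      (larger (p⊆p∪q _ , u , q⊆p∪q Z _ (x∈⁅x⁆ _) , Lobe.disjoint lobe u∈L))
  absorb bridgeless {Z} larger (ear {L} {e} a b lobe e≢f x∈L ea∈Z y∈L fb∈Z flow) =
    absorb-ear a b lobe e≢f x∈L ea∈Z y∈L fb∈Z flow Q
      (larger (p⊆p∪q _ , src e a , q⊆p∪q Z _ (Reach.x∈R Q) , Lobe.disjoint lobe x∈L))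
    where
    open UnitFlow flow
    Q : Reach (Support g) L (src e a)
    Q = reach (λ h _ → ¬? (g h ≟ᶻ 0ℤ)) (λ {h} {c} g≢0 → tgt-src h {_∈ L} (inside h g≢0) c) x∈L

  -- The search for something to absorb starts from the whole complement of `Z`, a lobe without
  -- exits; each absorption refers to a strictly larger contracted set.
  contracted-flow : Bridgeless G → ∀ {Z} → Acc (λ p q → q ⊂ p) Z → Solution Z
  contracted-flow bridgeless {Z} (acc rec) with any? (λ v → ¬? (v ∈? Z))
  ... | yes (u , u∉Z) =
    absorb bridgeless (λ Z⊂Z′ → contracted-flow bridgeless (rec Z⊂Z′))
           (choose (x∉p⇒x∈∁p u∉Z) complement (⊂-wellFounded (∁ Z)))
    where
    complement : Lobe Z (∁ Z)
    complement = record
      { disjoint = x∈∁p⇒x∉p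
      ; exit = λ { (_ , _ , t∉∁Z , t∉Z) → contradiction (x∉p⇒x∈∁p t∉Z) t∉∁Z } }
  -- With every vertex contracted no balance is required, so the constants 0 and 1 will do.
  ... | no everything = record
    { α     = λ _ → 0ℤ
    ; β     = λ _ → 1ℤ
    ; nz    = λ _ → inj₂ λ 3∣1 → contradiction (∣⇒∣ᵤ 3∣1) (ℕ.>⇒∤ (ℕ.s≤s (ℕ.s≤s ℕ.z≤n)))
    ; α-Z   = λ _ _ _ → refl
    ; α-bal = λ {v} v∉Z → contradiction (v , v∉Z) everything
    ; β-bal = λ {v} v∉Z → contradiction (v , v∉Z) everything
    }

  -- Combining the two flows into a 6-flow

  outflow-inflow : ∀ φ v → outflow G +-0-abelianGroup φ v - inflow G +-0-abelianGroup φ v ≡ net φ v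
  outflow-inflow φ v = trans (cong (_- inflow G +-0-abelianGroup φ v) split)
                             (cancel (net φ v) (inflow G +-0-abelianGroup φ v))
    where
    at-tail at-head : Edge → ℤ
    at-tail e = if does (tail e ≟ᶠ v) then φ e else 0ℤ
    at-head e = if does (head e ≟ᶠ v) then φ e else 0ℤ
    term : ∀ e → at-tail e ≡ φ e * inc e v + at-head e
    term e with does (tail e ≟ᶠ v) | does (head e ≟ᶠ v)
    ... | true  | true  = lemma (φ e)
      where
      lemma : ∀ a → a ≡ a * 0ℤ + a
      lemma = solve-∀
    ... | true  | false = lemma (φ e)
      where
      lemma : ∀ a → a ≡ a * 1ℤ + 0ℤ
      lemma = solve-∀
    ... | false | true  = lemma (φ e)
      where
      lemma : ∀ a → 0ℤ ≡ a * -1ℤ + a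
      lemma = solve-∀
    ... | false | false = lemma (φ e)
      where
      lemma : ∀ a → 0ℤ ≡ a * 0ℤ + 0ℤ
      lemma = solve-∀
    split : sum at-tail ≡ net φ v + sum at-head
    split = trans (sum-cong-≗ term) (∑-distrib-+ (λ e → φ e * inc e v) at-head)
    cancel : ∀ a b → a + b - b ≡ a
    cancel = solve-∀

  -- The combination `3α + 2β` is `α` modulo 2 and `-β` modulo 3, so it vanishes modulo 6 only if
  -- both residues do. Starting from the empty contracted set gives balance at every vertex.
  six-flow : Bridgeless G → Σ[ φ ∈ (Edge → ℤ) ] (∀ v → + 6 ∣ net φ v) × (∀ e → ¬ + 6 ∣ φ e)
  six-flow bridgeless = φ , balanced , nowhere-zero
    where
    open Solution (contracted-flow bridgeless (⊃-wellFounded ⊥))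
    φ : Edge → ℤ
    φ e = + 3 * α e + + 2 * β e
    combine : ∀ {a b} → + 2 ∣ a → + 3 ∣ b → + 6 ∣ + 3 * a + + 2 * b
    combine (divides p refl) (divides q refl) = divides (p + q) (lemma p q)
      where
      lemma : ∀ p q → + 3 * (p * + 2) + + 2 * (q * + 3) ≡ (p + q) * + 6
      lemma = solve-∀
    balanced : ∀ v → + 6 ∣ net φ v
    balanced v = subst (+ 6 ∣_)
      (sym (trans (net-+ (λ e → + 3 * α e) (λ e → + 2 * β e) v)
                  (cong₂ _+_ (net-scale (+ 3) α v) (net-scale (+ 2) β v))))
      (combine (α-bal ∉⊥) (β-bal ∉⊥))
    nowhere-zero : ∀ e → ¬ + 6 ∣ φ e
    nowhere-zero e 6∣φ with nz e
    ... | inj₁ 2∤α = 2∤α (subst (+ 2 ∣_) (lemma (α e) (β e))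
      (∣m∣n⇒∣m-n (∣-trans (divides (+ 3) refl) 6∣φ) (divides (α e + β e) refl)))
      where
      lemma : ∀ a b → + 3 * a + + 2 * b - (a + b) * + 2 ≡ a
      lemma = solve-∀
    ... | inj₂ 3∤β = 3∤β (subst (+ 3 ∣_) (lemma (α e) (β e))
      (∣m∣n⇒∣m-n (divides (α e + β e) refl) (∣-trans (divides (+ 2) refl) 6∣φ)))
      where
      lemma : ∀ a b → (a + b) * + 3 - (+ 3 * a + + 2 * b) ≡ b
      lemma = solve-∀

-- From a flow modulo 6 to a double cover

-- Integers with congruence as equality: the operations are those of `ℤ`, so sums of flow values
-- need no reduction.
ℤ/6 : AbelianGroup 0ℓ 0ℓ
ℤ/6 = record
  { Carrier = ℤ
  ; _≈_ = λ m n → + 6 ∣ m - n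
  ; _∙_ = _+_
  ; ε = 0ℤ
  ; _⁻¹ = -_
  ; isAbelianGroup = record
    { isGroup = record
      { isMonoid = record
        { isSemigroup = record
          { isMagma = record
            { isEquivalence = record
              { refl  = λ {m} → ≡⇒≈ {m} refl
              ; sym   = λ {m} {n} p → subst (+ 6 ∣_) (flip m n) (∣m⇒∣-m p)
              ; trans = λ {m} {n} {o} p q → subst (+ 6 ∣_) (telescope m n o) (∣m∣n⇒∣m+n p q)
              }
            ; ∙-cong = λ {m} {n} {o} {p} q r →
                subst (+ 6 ∣_) (exchange m n o p) (∣m∣n⇒∣m+n q r)
            }
          ; assoc = λ m n o → ≡⇒≈ (+-assoc m n o)
          }
        ; identity = (λ m → ≡⇒≈ (+-identityˡ m)) , (λ m → ≡⇒≈ (+-identityʳ m))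
        }
      ; inverse = (λ m → ≡⇒≈ (+-inverseˡ m)) , (λ m → ≡⇒≈ (+-inverseʳ m))
      ; ⁻¹-cong = λ {m} {n} p → subst (+ 6 ∣_) (negate m n) (∣m⇒∣-m p)
      }
    ; comm = λ m n → ≡⇒≈ (+-comm m n)
    }
  }
  where
  ≡⇒≈ : ∀ {m n} → m ≡ n → + 6 ∣ m - n
  ≡⇒≈ {m} refl = divides 0ℤ (+-inverseʳ m)
  flip : ∀ m n → - (m - n) ≡ n - m
  flip = solve-∀
  telescope : ∀ m n o → m - n + (n - o) ≡ m - o
  telescope = solve-∀
  exchange : ∀ m n o p → m - n + (o - p) ≡ m + o - (n + p)
  exchange = solve-∀
  negate : ∀ m n → - (m - n) ≡ - m - - n
  negate = solve-∀

NonZeros : SymmetricSubset ℤ/6 0ℓ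
NonZeros = record
  { _∈B       = λ n → ¬ + 6 ∣ n
  ; respects  = λ {m} {n} m≈n 6∤m 6∣n → 6∤m (subst (+ 6 ∣_) (lemma m n) (∣m∣n⇒∣m+n m≈n 6∣n))
  ; symmetric = (λ {n} 6∤n 6∣-n → 6∤n (subst (+ 6 ∣_) (neg-involutive n) (∣m⇒∣-m 6∣-n))) ,
                (λ 6∤-n 6∣n → 6∤-n (∣m⇒∣-m 6∣n))
  }
  where
  lemma : ∀ m n → m - n + n ≡ m
  lemma = solve-∀

-- Roots in `ℤ⁶`

ℤ⁶ : AbelianGroup 0ℓ 0ℓ
ℤ⁶ = Pointwise.abelianGroup (Fin 6) +-0-abelianGroup

-- The differences of two distinct standard basis vectors.
record IsRoot (z : Fin 6 → ℤ) : Set where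
  field
    plus   : ∃! _≡_ λ i → z i ≡ 1ℤ
    minus  : ∃! _≡_ λ i → z i ≡ -1ℤ
    others : ∀ i → z i ≢ 1ℤ → z i ≢ -1ℤ → z i ≡ 0ℤ

root-resp : ∀ {y z} → (∀ i → y i ≡ z i) → IsRoot y → IsRoot z
root-resp y≗z root = record
  { plus   = let i , yi , unique = plus  in i , trans (sym (y≗z i)) yi , λ zj → unique (trans (y≗z _) zj)
  ; minus  = let i , yi , unique = minus in i , trans (sym (y≗z i)) yi , λ zj → unique (trans (y≗z _) zj)
  ; others = λ i z≢1 z≢-1 → trans (sym (y≗z i))
      (others i (λ yi → z≢1 (trans (sym (y≗z i)) yi)) (λ yi → z≢-1 (trans (sym (y≗z i)) yi)))
  }
  where open IsRoot root

neg-swap : ∀ {m n} → - m ≡ n → m ≡ - n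
neg-swap {m} refl = sym (neg-involutive m)

root-neg : ∀ {z} → IsRoot z → IsRoot (λ i → - z i)
root-neg root = record
  { plus   = let i , zi , unique = minus in i , cong -_ zi , λ zj → unique (neg-swap zj)
  ; minus  = let i , zi , unique = plus  in i , cong -_ zi , λ zj → unique (neg-swap zj)
  ; others = λ i z≢1 z≢-1 → cong -_ (others i (λ zi → z≢-1 (cong -_ zi)) (λ zi → z≢1 (cong -_ zi)))
  }
  where open IsRoot root

Roots : SymmetricSubset ℤ⁶ 0ℓ
Roots = record
  { _∈B       = IsRoot
  ; respects  = root-resp
  ; symmetric = root-neg , λ {z} root → root-resp (λ i → neg-involutive (z i)) (root-neg root)
  }

δ-δ-root : ∀ {r s : Fin 6} → r ≢ s → IsRoot (λ i → δ r i - δ s i)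
δ-δ-root {r} {s} r≢s = record
  { plus   = r , cong₂ _-_ (δ-refl r) (δ-≢ (r≢s ∘ sym)) , λ {j} → plus-unique j
  ; minus  = s , cong₂ _-_ (δ-≢ r≢s) (δ-refl s) , λ {j} → minus-unique j
  ; others = others
  }
  where
  plus-unique : ∀ j → δ r j - δ s j ≡ 1ℤ → r ≡ j
  plus-unique j eq with r ≟ᶠ j | s ≟ᶠ j
  ... | yes r≡j | _ = r≡j
  plus-unique j () | no _ | yes _
  plus-unique j () | no _ | no _
  minus-unique : ∀ j → δ r j - δ s j ≡ -1ℤ → s ≡ j
  minus-unique j eq with r ≟ᶠ j | s ≟ᶠ j
  ... | _ | yes s≡j = s≡j
  minus-unique j () | yes _ | no _
  minus-unique j () | no _ | no _
  others : ∀ j → δ r j - δ s j ≢ 1ℤ → δ r j - δ s j ≢ -1ℤ → δ r j - δ s j ≡ 0ℤ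
  others j ≢1 ≢-1 with r ≟ᶠ j | s ≟ᶠ j
  ... | yes _ | yes _ = refl
  ... | yes _ | no  _ = contradiction refl ≢1
  ... | no  _ | yes _ = contradiction refl ≢-1
  ... | no  _ | no  _ = refl

-- Residues and the homomorphism of Cayley graphs

residue : ℤ → Fin 6
residue n = fromℕ< (n%ℕd<d n 6)

-- The difference of the two remainders is divisible by 6 and smaller than 6 in absolute value,
-- hence zero.
residue-cong : ∀ {m n} → + 6 ∣ m - n → residue m ≡ residue n
residue-cong {m} {n} 6∣m-n = fromℕ<-cong _ _ (+-injective (i-j≡0⇒i≡j _ _ (∣i∣≡0⇒i≡0 small))) _ _
  where
  r = m %ℕ 6
  s = n %ℕ 6
  regroup : ∀ a b c d → a + c * + 6 - (b + d * + 6) - (c - d) * + 6 ≡ a - b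
  regroup = solve-∀
  6∣r-s : + 6 ∣ + r - + s
  6∣r-s = subst (+ 6 ∣_)
    (trans (cong₂ (λ i j → i - j - (m /ℕ 6 - n /ℕ 6) * + 6) (a≡a%ℕn+[a/ℕn]*n m 6) (a≡a%ℕn+[a/ℕn]*n n 6))
           (regroup (+ r) (+ s) (m /ℕ 6) (n /ℕ 6)))
    (∣m∣n⇒∣m-n 6∣m-n (divides (m /ℕ 6 - n /ℕ 6) refl))
  bound : abs (+ r - + s) ℕ.< 6
  bound = subst (λ i → abs i ℕ.< 6) (sym (m-n≡m⊖n r s))
    (ℕ.≤-<-trans (∣m⊝n∣≤m⊔n r s) (ℕ.⊔-lub (n%ℕd<d m 6) (n%ℕd<d n 6)))
  small : abs (+ r - + s) ≡ 0
  small with abs (+ r - + s) | ∣⇒∣ᵤ 6∣r-s | bound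
  ... | ℕ.zero  | _   | _ = refl
  ... | ℕ.suc k | 6∣k | k<6 = contradiction 6∣k (ℕ.>⇒∤ k<6)

residue-injective : ∀ {m n} → residue m ≡ residue n → + 6 ∣ m - n
residue-injective {m} {n} eq = divides (m /ℕ 6 - n /ℕ 6)
  (trans (cong₂ _-_ (a≡a%ℕn+[a/ℕn]*n m 6) (a≡a%ℕn+[a/ℕn]*n n 6))
         (trans (cong (λ r → + (m %ℕ 6) + m /ℕ 6 * + 6 - (+ r + n /ℕ 6 * + 6)) (sym same))
                (cancel (+ (m %ℕ 6)) (m /ℕ 6) (n /ℕ 6))))
  where
  same : m %ℕ 6 ≡ n %ℕ 6
  same = fromℕ<-injective _ _ (n%ℕd<d m 6) (n%ℕd<d n 6) eq
  cancel : ∀ r p q → r + p * + 6 - (r + q * + 6) ≡ (p - q) * + 6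
  cancel = solve-∀

-- The map is not additive and cannot be applied to the values of a flow; the transfer of flows is
-- what the supposed statement provides.
unit-vector-hom : CayHom ℤ/6 NonZeros ℤ⁶ Roots
unit-vector-hom = record
  { f         = λ n → δ (residue n)
  ; cong      = λ {m} {n} m≈n i → cong (λ r → δ r i) (residue-cong {m} {n} m≈n)
  ; adjacency = λ {m} {n} 6∤n-m → δ-δ-root (6∤n-m ∘ residue-injective {n} {m})
  }

-- Coordinates of a root-valued flow

sum-pointwise : ∀ {n} (f : Fin n → Fin 6 → ℤ) k →
                Sum.sum (AbelianGroup.commutativeMonoid ℤ⁶) f k ≡ sum (λ i → f i k)
sum-pointwise {ℕ.zero}  f k = refl
sum-pointwise {ℕ.suc n} f k = cong (_+_ (f zero k)) (sum-pointwise (f ∘ suc) k)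

-- The six coordinates of the flow are the six cycles, and the root condition at `e` is the covering
-- condition at `e`.
double-cover : ∀ G → HasFlow G ℤ⁶ IsRoot → HasOrientableCycleDoubleCoverOfSize≤ G 6
double-cover G (φ , φ-flow , φ-root) = 6 , ℕ.≤-refl , C , record
  { cycles   = λ k → (λ v → trans (sym (coordinate k v)) (φ-flow v k)) , λ e → value k e
  ; forward  = λ e → IsRoot.plus (φ-root e)
  ; backward = λ e → IsRoot.minus (φ-root e)
  ; others   = λ e → IsRoot.others (φ-root e)
  }
  where
  open Graph G
  C : Fin 6 → Edge → ℤ
  C k e = φ e k
  at : (Edge → Vertex) → Vertex → Edge → Fin 6 → ℤ
  at end v e = if does (end e ≟ᶠ v) then φ e else AbelianGroup.ε ℤ⁶
  part : (end : Edge → Vertex) → ∀ k v →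
         Sum.sum (AbelianGroup.commutativeMonoid ℤ⁶) (at end v) k ≡
         sum (λ e → if does (end e ≟ᶠ v) then C k e else 0ℤ)
  part end k v = trans (sum-pointwise (at end v) k)
    (sum-cong-≗ λ e → if-float (λ (z : Fin 6 → ℤ) → z k) (does (end e ≟ᶠ v)))
  coordinate : ∀ k v →
    AbelianGroup._-_ ℤ⁶ (outflow G ℤ⁶ φ v) (inflow G ℤ⁶ φ v) k ≡
    outflow G +-0-abelianGroup (C k) v - inflow G +-0-abelianGroup (C k) v
  coordinate k v = cong₂ _-_ (part tail k v) (part head k v)
  value : ∀ k e → C k e ≡ -1ℤ ⊎ C k e ≡ 0ℤ ⊎ C k e ≡ 1ℤ
  value k e with C k e ≟ᶻ -1ℤ | C k e ≟ᶻ 1ℤ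
  ... | yes ≡-1 | _      = inj₁ ≡-1
  ... | no  _   | yes ≡1 = inj₂ (inj₂ ≡1)
  ... | no  ≢-1 | no  ≢1 = inj₂ (inj₁ (IsRoot.others (φ-root e) k ≢1 ≢-1))

corollary16 : CayleyHomsPreserveFlows →
    (G : Graph) → Bridgeless G → HasOrientableCycleDoubleCoverOfSize≤ G 6
corollary16 preserve G bridgeless =
  double-cover G (preserve ℤ/6 ℤ⁶ NonZeros Roots unit-vector-hom G (φ , flow , nowhere-zero))
  where
  open Σ (six-flow G bridgeless) renaming (proj₁ to φ; proj₂ to φ-props)
  nowhere-zero = proj₂ φ-props
  flow : IsFlow G ℤ/6 φ
  flow v = subst (+ 6 ∣_)
    -- Being equal to `ε` in `ℤ/6` unfolds to divisibility of the difference with 0, hence the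
    -- subtraction.
    (sym (trans (cong (_- 0ℤ) (outflow-inflow G φ v)) (+-identityʳ (net G φ v))))
    (proj₁ φ-props v)
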